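{- There exists an infinite binary word over $\{0,1\}$ all of whose (finite) factors have exponent at most $7/3$ and which contains exactly $12$ distinct squares as factors. Moreover, $12$ is the fewest possible: every infinite binary word all of whose factors have exponent at most $7/3$ contains at least $12$ distinct squares as factors.
   Context: A word has period $p$ if its letters at distance $p$ are equal. The exponent of a nonempty finite word is its length divided by its smallest period. A square is a word of the form $uu$ with $u$ a nonempty finite word. A factor of a word is a contiguous finite subword; squares are counted as distinct words (regardless of the number of occurrences). -}

module Defs where

open import Data.Bool using (Bool)
open import Data.Nat using (ℕ; zero; suc; _+_; _*_; _≤_; _<_)
open import Data.List using (List; []; _∷_; _++_; length)
open import Data.List.Membership.Propositional using (_∈_)
open import Data.List.Relation.Unary.Unique.Propositional using (Unique)
open import Data.Product using (Σ; ∃; _×_; _,_)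
open import Relation.Binary.PropositionalEquality using (_≡_)

-- An infinite binary word over {0,1} (false = 0, true = 1).
InfWord : Set
InfWord = ℕ → Bool

factor : InfWord → ℕ → ℕ → List Bool
factor w i zero    = []
factor w i (suc n) = w i ∷ factor w (suc i) n

-- Period p ≥ 1 of a finite word (given as the factor of w at i of length n):
-- letters at distance p are equal.
HasPeriod : InfWord → ℕ → ℕ → ℕ → Set
HasPeriod w i n p = (1 ≤ p) × (∀ j → j + p < n → w (i + j) ≡ w (i + j + p))

IsSmallestPeriod : InfWord → ℕ → ℕ → ℕ → Set
IsSmallestPeriod w i n p = HasPeriod w i n p × (∀ q → HasPeriod w i n q → p ≤ q)

-- All nonempty finite factors have exponent (length / smallest period) at most 7/3,
-- i.e. 3 * length ≤ 7 * smallestPeriod.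
ExponentAtMost7/3 : InfWord → Set
ExponentAtMost7/3 w =
  ∀ i n p → 1 ≤ n → IsSmallestPeriod w i n p → 3 * n ≤ 7 * p

IsSquare : List Bool → Set
IsSquare x = Σ (List Bool) λ u → (1 ≤ length u) × (x ≡ u ++ u)

IsFactor : List Bool → InfWord → Set
IsFactor x w = Σ ℕ λ i → factor w i (length x) ≡ x

SquareFactor : InfWord → List Bool → Set
SquareFactor w x = IsSquare x × IsFactor x w

ExactlySquares : ℕ → InfWord → Set
ExactlySquares k w =
  Σ (List (List Bool)) λ L →
    Unique L × (length L ≡ k) × (∀ x → (x ∈ L → SquareFactor w x) × (SquareFactor w x → x ∈ L))

AtLeastSquares : ℕ → InfWord → Set
AtLeastSquares k w =
  Σ (List (List Bool)) λ L →
    Unique L × (length L ≡ k) × (∀ x → x ∈ L → SquareFactor w x)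

{-# OPTIONS --safe #-}
module Submission where

open import Defs
open import Data.Bool using (Bool; true; false; if_then_else_; not; _∧_; T)
open import Data.Bool.ListAction using (all)
import Data.Bool.Properties as Boolₚ
open import Data.List using
  (List; []; _∷_; _++_; length; map; reverse; take; drop; concatMap; upTo; foldr; filter; deduplicate)
open import Data.List.Membership.Propositional using (_∈_; lose)
open import Data.List.Membership.Propositional.Properties using (∈-upTo⁺; ∈-map⁺; ∈-concatMap⁺; ∈-deduplicate⁺)
import Data.List.Membership.DecPropositional as DecMembership
open import Data.List.Properties
open import Data.List.Relation.Unary.All as All using (All; []; _∷_)
import Data.List.Relation.Unary.All.Properties as Allₚ
import Data.List.Relation.Unary.AllPairs as AllPairs
open import Data.List.Relation.Unary.Any as Any using (Any; here; there)
open import Data.List.Relation.Unary.Unique.Propositional using (Unique)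
import Data.List.Relation.Unary.Unique.DecPropositional as DecUnique
import Data.List.Relation.Unary.Unique.Propositional.Properties as Uniqueₚ
open import Data.Nat
open import Data.Nat.DivMod
open import Data.Nat.Induction using (<-rec)
open import Data.Nat.Properties
open import Data.Nat.Tactic.RingSolver using (solve-∀)
open import Data.Product using (Σ; ∃; ∃₂; _×_; _,_; proj₁; proj₂)
open import Data.Sum using (inj₁; inj₂)
open import Function using (_∘_; Equivalence)
open import Relation.Binary.Definitions using (DecidableEquality)
open import Relation.Binary.PropositionalEquality
open import Relation.Nullary
open import Relation.Nullary.Decidable using (True; isYes; _×-dec_; _→-dec_; map′; toWitness; from-yes)

-- The word is w = g(b), where b is the fixed point of the morphism f on six letters; it is also
-- gf(b) with gf = g ∘ f. A square of w of period p ≥ 96 sits in gf(b). Reading off the blocks of gf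
-- around its beginning, its middle and its end shows that p is the length of gf(v) for a factor v of
-- b, and that g(b) = w contains a square of period |g(v)|, which is less than p but at least p / 5.
-- This descent ends at a period between 20 and 95, where a finite check finds no square. (The word b
-- itself could not be used for the descent: g creates squares from patterns of b that are not
-- squares, so squarefreeness of b would not be a sufficient induction hypothesis.) The remaining
-- squares and powers are short and are enumerated.
--
-- For the lower bound, a backtracking search shows that a binary word of length 118 without factors
-- of exponent greater than 7/3 contains 12 squares.

private variable X Y Z : Set

-- Infinite words and their images under morphisms

-- For `j = i + p` with `p` positive, this says that the factor of length `p + n` at `i` has period
-- `p`; the case `n = p` is a square.
Agree : (ℕ → X) → ℕ → ℕ → ℕ → Set
Agree u i j n = ∀ t → t < n → u (i + t) ≡ u (j + t)

Agree-tail : (u : ℕ → X) → ∀ {i j n} → Agree u i j (suc n) → Agree u (suc i) (suc j) n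
Agree-tail u {i} {j} ag t t<n =
  trans (cong u (sym (+-suc i t))) (trans (ag (suc t) (s≤s t<n)) (cong u (+-suc j t)))

Agree-head : (u : ℕ → X) → ∀ {i j n} → Agree u i j (suc n) → u i ≡ u j
Agree-head u {i} {j} ag =
  trans (cong u (sym (+-identityʳ i))) (trans (ag 0 z<s) (cong u (+-identityʳ j)))

Agree-cons : (u : ℕ → X) → ∀ {i j n} → u i ≡ u j → Agree u (suc i) (suc j) n → Agree u i j (suc n)
Agree-cons u {i} {j} eq ag zero    _   = trans (cong u (+-identityʳ i)) (trans eq (cong u (sym (+-identityʳ j))))
Agree-cons u {i} {j} eq ag (suc t) t<n =
  trans (cong u (+-suc i t)) (trans (ag t (s≤s⁻¹ t<n)) (cong u (sym (+-suc j t))))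

Agree-++ : (u : ℕ → X) → ∀ {i j} m n → Agree u i j m → Agree u (i + m) (j + m) n → Agree u i j (m + n)
Agree-++ u {i} {j} m n ag₁ ag₂ t t<m+n with <-≤-connex t m
... | inj₁ t<m = ag₁ t t<m
... | inj₂ m≤t = subst (λ s → u (i + s) ≡ u (j + s)) (m+[n∸m]≡n m≤t)
  (trans (cong u (sym (+-assoc i m s)))
  (trans (ag₂ s (+-cancelˡ-< m s n (subst (_< m + n) (sym (m+[n∸m]≡n m≤t)) t<m+n)))
         (cong u (+-assoc j m s))))
  where s = t ∸ m

Agree-sub : (u : ℕ → X) → ∀ {i j n} s m → s + m ≤ n → Agree u i j n → Agree u (i + s) (j + s) m
Agree-sub u {i} {j} s m s+m≤n ag t t<m =
  trans (cong u (+-assoc i s t))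
  (trans (ag (s + t) (<-≤-trans (+-monoʳ-< s t<m) s+m≤n)) (cong u (sym (+-assoc j s t))))

window : (ℕ → X) → ℕ → ℕ → List X
window u i zero    = []
window u i (suc n) = u i ∷ window u (suc i) n

length-window : (u : ℕ → X) → ∀ i n → length (window u i n) ≡ n
length-window u i zero    = refl
length-window u i (suc n) = cong suc (length-window u (suc i) n)

window-++ : (u : ℕ → X) → ∀ i m n → window u i (m + n) ≡ window u i m ++ window u (i + m) n
window-++ u i zero    n = cong (λ k → window u k n) (sym (+-identityʳ i))
window-++ u i (suc m) n = cong (u i ∷_)
  (trans (window-++ u (suc i) m n) (cong (λ k → window u (suc i) m ++ window u k n) (sym (+-suc i m))))

take-window : (u : ℕ → X) → ∀ i m n → m ≤ n → take m (window u i n) ≡ window u i m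
take-window u i zero    n       m≤n = refl
take-window u i (suc m) (suc n) m≤n = cong (u i ∷_) (take-window u (suc i) m n (s≤s⁻¹ m≤n))

drop-window : (u : ℕ → X) → ∀ i m n → drop m (window u i (m + n)) ≡ window u (i + m) n
drop-window u i zero    n = cong (λ k → window u k n) (sym (+-identityʳ i))
drop-window u i (suc m) n =
  trans (drop-window u (suc i) m n) (cong (λ k → window u k n) (sym (+-suc i m)))

take-drop-window : (u : ℕ → X) → ∀ i m k n → m + k ≤ n → take k (drop m (window u i n)) ≡ window u (i + m) k
take-drop-window u i m k n m+k≤n = begin
  take k (drop m (window u i n))              ≡⟨ cong (take k ∘ drop m ∘ window u i) (sym (m+[n∸m]≡n m≤n)) ⟩
  take k (drop m (window u i (m + (n ∸ m))))  ≡⟨ cong (take k) (drop-window u i m (n ∸ m)) ⟩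
  take k (window u (i + m) (n ∸ m))           ≡⟨ take-window u (i + m) k (n ∸ m) k≤n∸m ⟩
  window u (i + m) k                          ∎
  where
  open ≡-Reasoning
  m≤n = ≤-trans (m≤m+n m k) m+k≤n
  k≤n∸m = subst (_≤ n ∸ m) (m+n∸m≡n m k) (∸-monoˡ-≤ m m+k≤n)

Agree⇒window : (u : ℕ → X) → ∀ i j n → Agree u i j n → window u i n ≡ window u j n
Agree⇒window u i j zero    ag = refl
Agree⇒window u i j (suc n) ag =
  cong₂ _∷_ (Agree-head u ag) (Agree⇒window u (suc i) (suc j) n (Agree-tail u ag))

window⇒Agree : (u : ℕ → X) → ∀ i j n → window u i n ≡ window u j n → Agree u i j n
window⇒Agree u i j (suc n) eq =
  Agree-cons u (∷-injectiveˡ eq) (window⇒Agree u (suc i) (suc j) n (∷-injectiveʳ eq))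

++-injective : (xs xs′ : List X) {ys ys′ : List X} → length xs ≡ length xs′ →
               xs ++ ys ≡ xs′ ++ ys′ → xs ≡ xs′ × ys ≡ ys′
++-injective []       []         len eq = refl , eq
++-injective (x ∷ xs) (x′ ∷ xs′) len eq with ++-injective xs xs′ (suc-injective len) (∷-injectiveʳ eq)
... | xs≡ , ys≡ = cong₂ _∷_ (∷-injectiveˡ eq) xs≡ , ys≡

length-concatMap-++ : (h : X → List Y) → ∀ xs ys →
  length (concatMap h (xs ++ ys)) ≡ length (concatMap h xs) + length (concatMap h ys)
length-concatMap-++ h xs ys = trans (cong length (concatMap-++ h xs ys)) (length-++ (concatMap h xs))

concatMap-∘ : (k : Y → List Z) (h : X → List Y) → ∀ xs →
  concatMap k (concatMap h xs) ≡ concatMap (concatMap k ∘ h) xs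
concatMap-∘ k h []       = refl
concatMap-∘ k h (x ∷ xs) =
  trans (concatMap-++ k (h x) (concatMap h xs)) (cong (concatMap k (h x) ++_) (concatMap-∘ k h xs))

concatMap-length≥ : (h : X → List Y) → ∀ m → (∀ x → m ≤ length (h x)) →
  ∀ xs → length xs * m ≤ length (concatMap h xs)
concatMap-length≥ h m h≥ []       = z≤n
concatMap-length≥ h m h≥ (x ∷ xs) = begin
  m + length xs * m                          ≤⟨ +-mono-≤ (h≥ x) (concatMap-length≥ h m h≥ xs) ⟩
  length (h x) + length (concatMap h xs)     ≡⟨ sym (length-++ (h x)) ⟩
  length (h x ++ concatMap h xs)             ∎
  where open ≤-Reasoning

concatMap-length≤ : (h : X → List Y) → ∀ m → (∀ x → length (h x) ≤ m) →
  ∀ xs → length (concatMap h xs) ≤ length xs * m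
concatMap-length≤ h m h≤ []       = z≤n
concatMap-length≤ h m h≤ (x ∷ xs) = begin
  length (h x ++ concatMap h xs)             ≡⟨ length-++ (h x) ⟩
  length (h x) + length (concatMap h xs)     ≤⟨ +-mono-≤ (h≤ x) (concatMap-length≤ h m h≤ xs) ⟩
  m + length xs * m                          ∎
  where open ≤-Reasoning

-- pos h u n is the position in the image of u where the block of the letter u n begins.
pos : (X → List Y) → (ℕ → X) → ℕ → ℕ
pos h u n = length (concatMap h (window u 0 n))

-- Being the image of an infinite word is expressed through prefixes, since `concatMap` acts on
-- finite words.
IsImage : (X → List Y) → (ℕ → X) → (ℕ → Y) → Set
IsImage h u v = ∀ n → window v 0 (pos h u n) ≡ concatMap h (window u 0 n)

pos-+ : (h : X → List Y) (u : ℕ → X) → ∀ n m → pos h u (n + m) ≡ pos h u n + length (concatMap h (window u n m))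
pos-+ h u n m = trans (cong (length ∘ concatMap h) (window-++ u 0 n m))
                      (length-concatMap-++ h (window u 0 n) (window u n m))

pos-suc : (h : X → List Y) (u : ℕ → X) → ∀ n → pos h u (suc n) ≡ pos h u n + length (h (u n))
pos-suc h u n = begin
  pos h u (suc n)                           ≡⟨ cong (pos h u) (+-comm 1 n) ⟩
  pos h u (n + 1)                           ≡⟨ pos-+ h u n 1 ⟩
  pos h u n + length (h (u n) ++ [])        ≡⟨ cong (λ v → pos h u n + length v) (++-identityʳ (h (u n))) ⟩
  pos h u n + length (h (u n))              ∎
  where open ≡-Reasoning

pos-mono-≤ : (h : X → List Y) (u : ℕ → X) → ∀ {m n} → m ≤ n → pos h u m ≤ pos h u n
pos-mono-≤ h u {m} {n} m≤n = begin
  pos h u m              ≤⟨ m≤m+n (pos h u m) _ ⟩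
  pos h u m + length (concatMap h (window u m (n ∸ m)))  ≡⟨ sym (pos-+ h u m (n ∸ m)) ⟩
  pos h u (m + (n ∸ m))  ≡⟨ cong (pos h u) (m+[n∸m]≡n m≤n) ⟩
  pos h u n              ∎
  where open ≤-Reasoning

-- The images of the first `n` and the first `n + m` letters are both prefixes of `v`; cancelling
-- the shorter one leaves the claim.
window-image : {h : X → List Y} {u : ℕ → X} {v : ℕ → Y} → IsImage h u v → ∀ n m →
  window v (pos h u n) (length (concatMap h (window u n m))) ≡ concatMap h (window u n m)
window-image {h = h} {u} {v} image n m =
  proj₂ (++-injective (window v 0 (pos h u n)) (concatMap h (window u 0 n)) (length-window v 0 (pos h u n)) (begin
    window v 0 (pos h u n) ++ window v (pos h u n) (length (concatMap h (window u n m)))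
      ≡⟨ sym (window-++ v 0 (pos h u n) _) ⟩
    window v 0 (pos h u n + length (concatMap h (window u n m)))
      ≡⟨ cong (window v 0) (sym (pos-+ h u n m)) ⟩
    window v 0 (pos h u (n + m))
      ≡⟨ image (n + m) ⟩
    concatMap h (window u 0 (n + m))
      ≡⟨ cong (concatMap h) (window-++ u 0 n m) ⟩
    concatMap h (window u 0 n ++ window u n m)
      ≡⟨ concatMap-++ h (window u 0 n) (window u n m) ⟩
    concatMap h (window u 0 n) ++ concatMap h (window u n m) ∎))
  where open ≡-Reasoning

window-in-image : {h : X → List Y} {u : ℕ → X} {v : ℕ → Y} → IsImage h u v → ∀ n m r k →
  r + k ≤ length (concatMap h (window u n m)) →
  window v (pos h u n + r) k ≡ take k (drop r (concatMap h (window u n m)))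
window-in-image {h = h} {u} {v} image n m r k r+k≤ =
  trans (sym (take-drop-window v (pos h u n) r k _ r+k≤))
        (cong (take k ∘ drop r) (window-image image n m))

IsImage-∘ : {h : X → List Y} {k : Y → List Z} {u : ℕ → X} {v : ℕ → Y} {z : ℕ → Z} →
  IsImage h u v → IsImage k v z → IsImage (concatMap k ∘ h) u z
IsImage-∘ {h = h} {k} {u} {v} {z} imh imk n = subst (λ x → window z 0 (length x) ≡ x) (begin
    concatMap k (window v 0 (pos h u n))         ≡⟨ cong (concatMap k) (imh n) ⟩
    concatMap k (concatMap h (window u 0 n))     ≡⟨ concatMap-∘ k h (window u 0 n) ⟩
    concatMap (concatMap k ∘ h) (window u 0 n)   ∎) (imk (pos h u n))
  where open ≡-Reasoning

locate : (h : X → List Y) (u : ℕ → X) → (∀ x → 1 ≤ length (h x)) →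
  ∀ i → ∃₂ λ n r → i ≡ pos h u n + r × r < length (h (u n))
locate h u nonempty zero    = 0 , 0 , refl , nonempty (u 0)
locate h u nonempty (suc i) with locate h u nonempty i
... | n , r , refl , r<len with m≤n⇒m<n∨m≡n r<len
...   | inj₁ 1+r<len = n , suc r , sym (+-suc (pos h u n) r) , 1+r<len
...   | inj₂ 1+r≡len = suc n , 0 , eq , nonempty (u (suc n))
  where
  eq : suc (pos h u n + r) ≡ pos h u (suc n) + 0
  eq = begin
    suc (pos h u n + r)            ≡⟨ sym (+-suc (pos h u n) r) ⟩
    pos h u n + suc r              ≡⟨ cong (pos h u n +_) 1+r≡len ⟩
    pos h u n + length (h (u n))   ≡⟨ sym (pos-suc h u n) ⟩
    pos h u (suc n)                ≡⟨ sym (+-identityʳ _) ⟩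
    pos h u (suc n) + 0            ∎
    where open ≡-Reasoning

concatMap-length-ratio : (h : X → List Y) (k : X → List Z) → ∀ m n →
  (∀ x → m * length (h x) ≤ n * length (k x)) →
  ∀ xs → m * length (concatMap h xs) ≤ n * length (concatMap k xs)
concatMap-length-ratio h k m n ratio []       = ≤-reflexive (trans (*-zeroʳ m) (sym (*-zeroʳ n)))
concatMap-length-ratio h k m n ratio (x ∷ xs) = begin
  m * length (h x ++ concatMap h xs)                     ≡⟨ cong (m *_) (length-++ (h x)) ⟩
  m * (length (h x) + length (concatMap h xs))           ≡⟨ *-distribˡ-+ m (length (h x)) _ ⟩
  m * length (h x) + m * length (concatMap h xs)         ≤⟨ +-mono-≤ (ratio x) (concatMap-length-ratio h k m n ratio xs) ⟩
  n * length (k x) + n * length (concatMap k xs)         ≡⟨ sym (*-distribˡ-+ n (length (k x)) _) ⟩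
  n * (length (k x) + length (concatMap k xs))           ≡⟨ cong (n *_) (sym (length-++ (k x))) ⟩
  n * length (k x ++ concatMap k xs)                     ∎
  where open ≤-Reasoning

take-image : {h : X → List Y} {u : ℕ → X} {v : ℕ → Y} → IsImage h u v → ∀ n m k →
  k ≤ length (concatMap h (window u n m)) → window v (pos h u n) k ≡ take k (concatMap h (window u n m))
take-image {h = h} {u} {v} image n m k k≤ =
  trans (sym (take-window v (pos h u n) k _ k≤)) (cong (take k) (window-image image n m))

drop-image : {h : X → List Y} {u : ℕ → X} {v : ℕ → Y} → IsImage h u v → ∀ n m r →
  r ≤ length (concatMap h (window u n m)) →
  window v (pos h u n + r) (length (concatMap h (window u n m)) ∸ r) ≡ drop r (concatMap h (window u n m))
drop-image {h = h} {u} {v} image n m r r≤ = begin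
  window v (pos h u n + r) (len ∸ r)              ≡⟨ sym (drop-window v (pos h u n) r (len ∸ r)) ⟩
  drop r (window v (pos h u n) (r + (len ∸ r)))   ≡⟨ cong (drop r ∘ window v (pos h u n)) (m+[n∸m]≡n r≤) ⟩
  drop r (window v (pos h u n) len)               ≡⟨ cong (drop r) (window-image image n m) ⟩
  drop r (concatMap h (window u n m))             ∎
  where
  open ≡-Reasoning
  len = length (concatMap h (window u n m))

length-image-window≥ : (h : X → List Y) (u : ℕ → X) → ∀ m → (∀ x → m ≤ length (h x)) →
  ∀ i n → n * m ≤ length (concatMap h (window u i n))
length-image-window≥ h u m h≥ i n = subst (λ l → l * m ≤ length (concatMap h (window u i n)))
  (length-window u i n) (concatMap-length≥ h m h≥ (window u i n))

length-image-window≤ : (h : X → List Y) (u : ℕ → X) → ∀ m → (∀ x → length (h x) ≤ m) →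
  ∀ i n → length (concatMap h (window u i n)) ≤ n * m
length-image-window≤ h u m h≤ i n = subst (λ l → length (concatMap h (window u i n)) ≤ l * m)
  (length-window u i n) (concatMap-length≤ h m h≤ (window u i n))

-- Limits of growing sequences of prefixes

nth : X → List X → ℕ → X
nth x₀ []       n       = x₀
nth x₀ (x ∷ xs) zero    = x
nth x₀ (x ∷ xs) (suc n) = nth x₀ xs n

nth-++ : (x₀ : X) → ∀ xs ys {n} → n < length xs → nth x₀ (xs ++ ys) n ≡ nth x₀ xs n
nth-++ x₀ (x ∷ xs) ys {zero}  n< = refl
nth-++ x₀ (x ∷ xs) ys {suc n} n< = nth-++ x₀ xs ys (s≤s⁻¹ n<)

window-nth : (x₀ : X) (u : ℕ → X) → ∀ i xs → (∀ n → n < length xs → u (i + n) ≡ nth x₀ xs n) →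
  window u i (length xs) ≡ xs
window-nth x₀ u i []       eq = refl
window-nth x₀ u i (x ∷ xs) eq = cong₂ _∷_ (trans (cong u (sym (+-identityʳ i))) (eq 0 z<s))
  (window-nth x₀ u (suc i) xs λ n n< → trans (cong u (sym (+-suc i n))) (eq (suc n) (s≤s n<)))

-- The list `L n` has more than `n` letters, so letter `n` of the limit can be read off it and the
-- default `x₀` is never reached.
module Limit (x₀ : X) (L tail : ℕ → List X)
  (extends : ∀ k → L (suc k) ≡ L k ++ tail k) (grows : ∀ k → k < length (L k)) where

  limit : ℕ → X
  limit n = nth x₀ (L n) n

  nth-stable : ∀ k m n → n < length (L k) → n < length (L (m + k)) × nth x₀ (L (m + k)) n ≡ nth x₀ (L k) n
  nth-stable k zero    n n< = n< , refl
  nth-stable k (suc m) n n< with nth-stable k m n n<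
  ... | n<′ , eq rewrite extends (m + k) =
    <-≤-trans n<′ (subst (length (L (m + k)) ≤_) (sym (length-++ (L (m + k)))) (m≤m+n _ _)) ,
    trans (nth-++ x₀ (L (m + k)) (tail (m + k)) n<′) eq

  limit-nth : ∀ k n → n < length (L k) → limit n ≡ nth x₀ (L k) n
  limit-nth k n n< with ≤-total n k
  ... | inj₁ n≤k = sym (subst (λ j → nth x₀ (L j) n ≡ limit n) (m∸n+n≡m n≤k)
                             (proj₂ (nth-stable n (k ∸ n) n (grows n))))
  ... | inj₂ k≤n = subst (λ j → nth x₀ (L j) n ≡ nth x₀ (L k) n) (m∸n+n≡m k≤n)
                         (proj₂ (nth-stable k (n ∸ k) n n<))

  limit-prefix : ∀ k → window limit 0 (length (L k)) ≡ L k
  limit-prefix k = window-nth x₀ limit 0 (L k) (limit-nth k)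

-- The lower bound

_≟ᴮ_ : DecidableEquality (List Bool)
_≟ᴮ_ = ≡-dec Boolₚ._≟_

open DecMembership _≟ᴮ_ using (_∈?_)

swap-last : ∀ m n o → m + n + o ≡ m + o + n
swap-last = solve-∀

hasPeriod? : ∀ w i n p → Dec (HasPeriod w i n p)
hasPeriod? w i n p = (1 ≤? p) ×-dec
  map′ (λ h j j+p<n → h (≤-<-trans (m≤m+n j p) j+p<n) j+p<n) (λ h {j} _ → h j)
    (allUpTo? (λ j → (j + p <? n) →-dec (w (i + j) Boolₚ.≟ w (i + j + p))) n)

smallestPeriod : ∀ w i n p → HasPeriod w i n p → ∃ λ q → q ≤ p × IsSmallestPeriod w i n q
smallestPeriod w i n = <-rec _ step
  where
  step : ∀ p → (∀ {q} → q < p → HasPeriod w i n q → ∃ λ r → r ≤ q × IsSmallestPeriod w i n r) →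
         HasPeriod w i n p → ∃ λ q → q ≤ p × IsSmallestPeriod w i n q
  step p rec per with anyUpTo? (hasPeriod? w i n) p
  ... | yes (q , q<p , perq) =
    let (r , r≤q , sm) = rec q<p perq in r , ≤-trans r≤q (<⇒≤ q<p) , sm
  ... | no none = p , ≤-refl , per , λ q perq → ≮⇒≥ λ q<p → none (q , q<p , perq)

-- Every period is at least the smallest one, so later arguments can use any period without showing
-- it to be minimal.
period-bound : ∀ w → ExponentAtMost7/3 w → ∀ i n p → 1 ≤ n → HasPeriod w i n p → 3 * n ≤ 7 * p
period-bound w expo i n p 1≤n per =
  let (q , q≤p , sm) = smallestPeriod w i n p per
  in ≤-trans (expo i n q 1≤n sm) (*-monoʳ-≤ 7 q≤p)

factor≡window : ∀ w i n → factor w i n ≡ window w i n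
factor≡window w i zero    = refl
factor≡window w i (suc n) = cong (w i ∷_) (factor≡window w (suc i) n)

length-factor : ∀ w i n → length (factor w i n) ≡ n
length-factor w i n = trans (cong length (factor≡window w i n)) (length-window w i n)

factor-++ : ∀ w i m n → factor w i (m + n) ≡ factor w i m ++ factor w (i + m) n
factor-++ w i m n rewrite factor≡window w i (m + n) | factor≡window w i m | factor≡window w (i + m) n =
  window-++ w i m n

Agree⇒factor : ∀ w i j n → Agree w i j n → factor w i n ≡ factor w j n
Agree⇒factor w i j n ag rewrite factor≡window w i n | factor≡window w j n = Agree⇒window w i j n ag

square-factor : ∀ w i p → 1 ≤ p → Agree w i (i + p) p → SquareFactor w (factor w i (p + p))
square-factor w i p 1≤p ag =
  ( factor w i p
  , subst (1 ≤_) (sym (length-factor w i p)) 1≤p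
  , trans (factor-++ w i p p) (cong (factor w i p ++_) (sym (Agree⇒factor w i (i + p) p ag))) )
  , i , cong (factor w i) (length-factor w i (p + p))

-- A list that ends early gives `false`, so `true` vouches for `k` letters of both lists.
prefixAgree : ℕ → List Bool → List Bool → Bool
prefixAgree zero    _        _        = true
prefixAgree (suc k) (x ∷ xs) (y ∷ ys) = if does (x Boolₚ.≟ y) then prefixAgree k xs ys else false
prefixAgree (suc k) _        _        = false

prefixAgree-window : ∀ u i j k m n → k ≤ m → k ≤ n → Agree u i j k →
  prefixAgree k (window u i m) (window u j n) ≡ true
prefixAgree-window u i j zero    m       n       _   _   _  = refl
prefixAgree-window u i j (suc k) (suc m) (suc n) k≤m k≤n ag with u i Boolₚ.≟ u j
... | yes _   = prefixAgree-window u (suc i) (suc j) k m n (s≤s⁻¹ k≤m) (s≤s⁻¹ k≤n) (Agree-tail u ag)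
... | no  u≢u = contradiction (Agree-head u ag) u≢u

history : InfWord → ℕ → List Bool
history w zero    = []
history w (suc n) = w n ∷ history w n

take-history : ∀ w i k → take k (history w (i + k)) ≡ reverse (factor w i k)
take-history w i zero    = refl
take-history w i (suc k) = begin
  take (suc k) (history w (i + suc k))       ≡⟨ cong (take (suc k) ∘ history w) (+-suc i k) ⟩
  w (i + k) ∷ take k (history w (i + k))     ≡⟨ cong (w (i + k) ∷_) (take-history w i k) ⟩
  w (i + k) ∷ reverse (factor w i k)         ≡⟨ sym (reverse-++ (factor w i k) (w (i + k) ∷ [])) ⟩
  reverse (factor w i k ++ w (i + k) ∷ [])   ≡⟨ cong reverse (sym (factor-++ w i k 1)) ⟩
  reverse (factor w i (k + 1))               ≡⟨ cong (reverse ∘ factor w i) (+-comm k 1) ⟩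
  reverse (factor w i (suc k))               ∎
  where open ≡-Reasoning

drop-history : ∀ w p n → drop p (history w n) ≡ history w (n ∸ p)
drop-history w zero    n       = refl
drop-history w (suc p) zero    = refl
drop-history w (suc p) (suc n) = drop-history w p n

prefixAgree-history : ∀ w k m n → prefixAgree k (history w m) (history w n) ≡ true →
  ∃₂ λ i j → m ≡ i + k × n ≡ j + k × Agree w i j k
prefixAgree-history w zero    m n eq = m , n , sym (+-identityʳ m) , sym (+-identityʳ n) , λ _ ()
prefixAgree-history w (suc k) (suc m) (suc n) eq with w m Boolₚ.≟ w n
... | yes wm≡wn with prefixAgree-history w k m n eq
...   | i , j , refl , refl , ag = i , j , sym (+-suc i k) , sym (+-suc j k) , ag′
  where
  ag′ : Agree w i j (suc k)
  ag′ t t<1+k with m≤n⇒m<n∨m≡n (s≤s⁻¹ t<1+k)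
  ... | inj₁ t<k  = ag t t<k
  ... | inj₂ refl = wm≡wn

-- Dropping `p` letters of a history moves its end back by `p`, so the comparison is between two
-- factors of `w` at distance `p`, the later one ending at `n`.
history-period : ∀ w p k n → 1 ≤ k → prefixAgree k (history w n) (drop p (history w n)) ≡ true →
  ∃ λ i → n ≡ i + p + k × Agree w i (i + p) k
history-period w p k@(suc _) n _ eq
  with prefixAgree-history w k n (n ∸ p) (subst (λ d → prefixAgree k (history w n) d ≡ true) (drop-history w p n) eq)
... | i , j , n≡i+k , n∸p≡j+k , ag = j , n≡ , λ t t<k → trans (sym (ag t t<k)) (cong (λ i → w (i + t)) i≡)
  where
  -- The agreement has at least one letter, so `n ∸ p` is positive and the subtraction was not
  -- truncated.
  p≤n : p ≤ n
  p≤n = <⇒≤ (m∸n≢0⇒n<m λ n∸p≡0 → m+1+n≢0 j (trans (sym n∸p≡j+k) n∸p≡0))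
  n≡ : n ≡ j + p + k
  n≡ = begin
    n            ≡⟨ sym (m+[n∸m]≡n p≤n) ⟩
    p + (n ∸ p)  ≡⟨ cong (p +_) n∸p≡j+k ⟩
    p + (j + k)  ≡⟨ sym (+-assoc p j k) ⟩
    p + j + k    ≡⟨ cong (_+ k) (+-comm p j) ⟩
    j + p + k    ∎
    where open ≡-Reasoning
  i≡ : i ≡ j + p
  i≡ = +-cancelʳ-≡ k i (j + p) (trans (sym n≡i+k) n≡)

-- The search keeps the word read so far as its history r, last letter first, so that a repetition
-- that ends at the last letter is an agreement of r with drop p r; agreement on suc (4 * p / 3)
-- letters means that the exponent exceeds 7/3. The squares found are stored reversed. Periods above 40
-- are not needed for the search tree to be finite.
full : List (List Bool) → Bool
full S = length S ≡ᵇ 12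

search : ℕ → List Bool → List (List Bool) → Bool
scan : ℕ → ℕ → ℕ → List Bool → List Bool → List (List Bool) → Bool
search zero    r S = false
search (suc f) r S = scan f 40 1 (true ∷ r) r S ∧ scan f 40 1 (false ∷ r) r S
scan f zero    p r d          S = search f r S
scan f (suc m) p r []         S = search f r S
scan f (suc m) p r d@(_ ∷ d′) S =
  if prefixAgree p r d
  then (if prefixAgree (suc (4 * p / 3)) r d then true else
        if does (take (p + p) r ∈? S) then scan f m (suc p) r d′ S else
        if full (take (p + p) r ∷ S) then true else
        scan f m (suc p) r d′ (take (p + p) r ∷ S))
  else scan f m (suc p) r d′ S

drop-suc : ∀ {A : Set} p (r : List A) {x d} → x ∷ d ≡ drop p r → d ≡ drop (suc p) r
drop-suc zero    (x ∷ r) refl = refl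
drop-suc (suc p) (x ∷ r) eq   = drop-suc p r eq

module _ (w : InfWord) (expo : ExponentAtMost7/3 w) where

  Found : List Bool → Set
  Found x = SquareFactor w (reverse x)

  full-sound : ∀ S → Unique S → All Found S → full S ≡ true → AtLeastSquares 12 w
  full-sound S uniq found eq =
    map reverse S , Uniqueₚ.map⁺ reverse-injective uniq ,
    trans (length-map reverse S) (≡ᵇ⇒≡ (length S) 12 (subst T (sym eq) _)) ,
    λ x x∈ → All.lookup (Allₚ.map⁺ found) x∈

  -- With `k` the least integer above `4 * p / 3`, the repetition has length `k + p`, more than
  -- `7/3` times its period.
  excess-contradiction : ∀ p n → 1 ≤ p →
    prefixAgree (suc (4 * p / 3)) (history w n) (drop p (history w n)) ≡ true → AtLeastSquares 12 w
  excess-contradiction p n 1≤p eq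
    with history-period w p (suc (4 * p / 3)) n z<s eq
  ... | i , _ , ag = contradiction bound (<⇒≱ excess)
    where
    k = suc (4 * p / 3)
    per : HasPeriod w i (k + p) p
    per = 1≤p , λ j j+p<k+p →
      trans (ag j (+-cancelʳ-< p j k j+p<k+p))
            (cong w (swap-last i p j))
    bound : 3 * (k + p) ≤ 7 * p
    bound = period-bound w expo i (k + p) p (s≤s z≤n) per
    excess : 7 * p < 3 * (k + p)
    excess = begin-strict
      7 * p           ≡⟨ *-distribʳ-+ p 4 3 ⟩
      4 * p + 3 * p   <⟨ +-monoˡ-< (3 * p) (m<[1+n/o]*o (4 * p) 3) ⟩
      k * 3 + 3 * p   ≡⟨ cong (_+ 3 * p) (*-comm k 3) ⟩
      3 * k + 3 * p   ≡⟨ sym (*-distribˡ-+ 3 k p) ⟩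
      3 * (k + p)     ∎
      where open ≤-Reasoning
            m<[1+n/o]*o : ∀ m o .{{_ : NonZero o}} → m < suc (m / o) * o
            m<[1+n/o]*o m o = subst (_< suc (m / o) * o) (sym (m≡m%n+[m/n]*n m o)) (+-monoˡ-< (m / o * o) (m%n<n m o))

  found-square : ∀ p n → 1 ≤ p → prefixAgree p (history w n) (drop p (history w n)) ≡ true →
                 Found (take (p + p) (history w n))
  found-square p n 1≤p eq with history-period w p p n 1≤p eq
  ... | i , refl , ag = subst (SquareFactor w) (sym (begin
      reverse (take (p + p) (history w (i + p + p)))    ≡⟨ cong (reverse ∘ take (p + p) ∘ history w) (+-assoc i p p) ⟩
      reverse (take (p + p) (history w (i + (p + p))))  ≡⟨ cong reverse (take-history w i (p + p)) ⟩
      reverse (reverse (factor w i (p + p)))            ≡⟨ reverse-involutive _ ⟩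
      factor w i (p + p)                                ∎)) (square-factor w i p 1≤p ag)
    where open ≡-Reasoning

  -- The letters of `w` select one branch of the search tree. Exhausted fuel yields `false`, so this
  -- branch was closed for a reason: either an excessive power, which `expo` excludes, or a twelfth
  -- square.
  search-sound : ∀ f n S → Unique S → All Found S → search f (history w n) S ≡ true → AtLeastSquares 12 w
  scan-sound : ∀ f m p n d S → 1 ≤ p → d ≡ drop p (history w n) → Unique S → All Found S →
               scan f m p (history w n) d S ≡ true → AtLeastSquares 12 w

  search-sound (suc f) n S uniq found eq with w n in wn≡
  ... | true  = scan-sound f 40 1 (suc n) (history w n) S ≤-refl refl uniq found
                  (subst (λ x → scan f 40 1 (x ∷ history w n) (history w n) S ≡ true) (sym wn≡) (Boolₚ.∧-conicalˡ _ _ eq))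
  ... | false = scan-sound f 40 1 (suc n) (history w n) S ≤-refl refl uniq found
                  (subst (λ x → scan f 40 1 (x ∷ history w n) (history w n) S ≡ true) (sym wn≡) (Boolₚ.∧-conicalʳ _ _ eq))

  scan-sound f zero    p n d S 1≤p d≡ uniq found eq = search-sound f n S uniq found eq
  scan-sound f (suc m) p n [] S 1≤p d≡ uniq found eq = search-sound f n S uniq found eq
  scan-sound f (suc m) p n d@(_ ∷ d′) S 1≤p d≡ uniq found eq
    with prefixAgree p (history w n) d in agree | drop-suc p (history w n) d≡
  ... | false | d′≡ = scan-sound f m (suc p) n d′ S z<s d′≡ uniq found eq
  ... | true  | d′≡ with prefixAgree (suc (4 * p / 3)) (history w n) d in excess
  ...   | true  = excess-contradiction p n 1≤p (subst (λ d → prefixAgree (suc (4 * p / 3)) (history w n) d ≡ true) d≡ excess)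
  ...   | false with take (p + p) (history w n) ∈? S
  ...     | yes _ = scan-sound f m (suc p) n d′ S z<s d′≡ uniq found eq
  ...     | no x∉S with full (take (p + p) (history w n) ∷ S) in fl
  ...       | true  = full-sound _ (Allₚ.¬Any⇒All¬ S x∉S AllPairs.∷ uniq) (sq ∷ found) fl
    where sq = found-square p n 1≤p (subst (λ d → prefixAgree p (history w n) d ≡ true) d≡ agree)
  ...       | false = scan-sound f m (suc p) n d′ _ z<s d′≡ (Allₚ.¬Any⇒All¬ S x∉S AllPairs.∷ uniq) (sq ∷ found) eq
    where sq = found-square p n 1≤p (subst (λ d → prefixAgree p (history w n) d ≡ true) d≡ agree)

  search-empty-sound : ∀ f → search f [] [] ≡ true → AtLeastSquares 12 w
  search-empty-sound f = search-sound f 0 [] AllPairs.[] []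

search-succeeds : search 118 [] [] ≡ true
search-succeeds = refl

lower-bound : (w : InfWord) → ExponentAtMost7/3 w → AtLeastSquares 12 w
lower-bound w expo = search-empty-sound w expo 118 search-succeeds

-- The word with 12 squares

data Letter : Set where
  a₀ a₁ b₀ b₁ c₀ d₀ : Letter

-- Deciding equality through numbers takes six cases instead of thirty-six.
encode : Letter → ℕ
encode a₀ = 0
encode a₁ = 1
encode b₀ = 2
encode b₁ = 3
encode c₀ = 4
encode d₀ = 5

decode : ℕ → Letter
decode 0 = a₀
decode 1 = a₁
decode 2 = b₀
decode 3 = b₁
decode 4 = c₀
decode _ = d₀

decode-encode : ∀ x → decode (encode x) ≡ x
decode-encode a₀ = refl
decode-encode a₁ = refl
decode-encode b₀ = refl
decode-encode b₁ = refl
decode-encode c₀ = refl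
decode-encode d₀ = refl

_≟ᴸ_ : DecidableEquality Letter
x ≟ᴸ y = map′ (λ eq → trans (sym (decode-encode x)) (trans (cong decode eq) (decode-encode y)))
              (cong encode) (encode x ≟ encode y)

_≟ᵂ_ : DecidableEquality (List Letter)
_≟ᵂ_ = ≡-dec _≟ᴸ_

-- A recoding of the morphisms of Badkobeh and Crochemore in which gf can be desubstituted from a
-- bounded part of its image; a₁ and b₁ are the occurrences of a and b that are followed by c₀, d₀.
f : Letter → List Letter
f a₀ = a₀ ∷ b₀ ∷ a₁ ∷ c₀ ∷ []
f a₁ = a₀ ∷ b₀ ∷ a₁ ∷ c₀ ∷ d₀ ∷ []
f b₀ = b₀ ∷ a₀ ∷ b₁ ∷ d₀ ∷ []
f b₁ = b₀ ∷ a₀ ∷ b₁ ∷ d₀ ∷ c₀ ∷ []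
f c₀ = a₀ ∷ b₁ ∷ d₀ ∷ c₀ ∷ []
f d₀ = b₀ ∷ a₁ ∷ c₀ ∷ d₀ ∷ []

pattern 𝟎 = false
pattern 𝟏 = true

g : Letter → List Bool
g a₀ = 𝟏 ∷ 𝟎 ∷ 𝟎 ∷ 𝟏 ∷ 𝟏 ∷ []
g a₁ = 𝟏 ∷ 𝟎 ∷ 𝟎 ∷ 𝟏 ∷ 𝟏 ∷ 𝟎 ∷ []
g b₀ = 𝟎 ∷ 𝟏 ∷ 𝟏 ∷ 𝟎 ∷ 𝟎 ∷ []
g b₁ = 𝟎 ∷ 𝟏 ∷ 𝟏 ∷ 𝟎 ∷ 𝟎 ∷ 𝟏 ∷ []
g c₀ = 𝟏 ∷ 𝟎 ∷ 𝟎 ∷ 𝟏 ∷ []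
g d₀ = 𝟎 ∷ 𝟏 ∷ 𝟏 ∷ 𝟎 ∷ []

letters : List Letter
letters = a₀ ∷ a₁ ∷ b₀ ∷ b₁ ∷ c₀ ∷ d₀ ∷ []

∈-letters : ∀ x → x ∈ letters
∈-letters a₀ = here refl
∈-letters a₁ = there (here refl)
∈-letters b₀ = there (there (here refl))
∈-letters b₁ = there (there (there (here refl)))
∈-letters c₀ = there (there (there (there (here refl))))
∈-letters d₀ = there (there (there (there (there (here refl)))))

forallLetters : {P : Letter → Set} (P? : ∀ x → Dec (P x)) {_ : True (All.all? P? letters)} → ∀ x → P x
forallLetters P? {t} x = All.lookup (toWitness t) (∈-letters x)

-- The fixed point of `f` and its image under `g`

fixedPrefix : ℕ → List Letter
fixedPrefix zero    = a₀ ∷ []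
fixedPrefix (suc k) = concatMap f (fixedPrefix k)

-- The word `f a₀` is `a₀` followed by `fixedTail 0`; applying `f` to this factorization `k` times
-- gives the letters by which the next prefix is longer.
fixedTail : ℕ → List Letter
fixedTail zero    = b₀ ∷ a₁ ∷ c₀ ∷ []
fixedTail (suc k) = concatMap f (fixedTail k)

fixedPrefix-extends : ∀ k → fixedPrefix (suc k) ≡ fixedPrefix k ++ fixedTail k
fixedPrefix-extends zero    = refl
fixedPrefix-extends (suc k) =
  trans (cong (concatMap f) (fixedPrefix-extends k)) (concatMap-++ f (fixedPrefix k) (fixedTail k))

|f|≥4 : ∀ x → 4 ≤ length (f x)
|f|≥4 = forallLetters (λ x → 4 ≤? length (f x))

|g|≥4 : ∀ x → 4 ≤ length (g x)
|g|≥4 = forallLetters (λ x → 4 ≤? length (g x))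

fixedPrefix-grows : ∀ k → k < length (fixedPrefix k)
fixedPrefix-grows zero    = s≤s z≤n
fixedPrefix-grows (suc k) = begin
  2 + k                             ≤⟨ +-mono-≤ {2} {4} (s≤s (s≤s z≤n)) (m≤m*n k 4) ⟩
  suc k * 4                         ≤⟨ *-monoˡ-≤ 4 (fixedPrefix-grows k) ⟩
  length (fixedPrefix k) * 4        ≤⟨ concatMap-length≥ f 4 |f|≥4 (fixedPrefix k) ⟩
  length (fixedPrefix (suc k))      ∎
  where open ≤-Reasoning

open Limit a₀ fixedPrefix fixedTail fixedPrefix-extends fixedPrefix-grows
  using () renaming (limit to b; limit-prefix to b-prefix)

-- The prefixes `fixedPrefix k` suffice, because the first `n` letters of `b` form a prefix of
-- `fixedPrefix n`.
image-of-b : {X : Set} (h : Letter → List X) (v : ℕ → X) →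
  (∀ k → window v 0 (length (concatMap h (fixedPrefix k))) ≡ concatMap h (fixedPrefix k)) → IsImage h b v
image-of-b h v prefix n = proj₁ (++-injective (window v 0 (pos h b n)) _ (length-window v 0 (pos h b n)) (begin
    window v 0 (pos h b n) ++ window v (pos h b n) (length (concatMap h rest))
      ≡⟨ sym (window-++ v 0 (pos h b n) _) ⟩
    window v 0 (pos h b n + length (concatMap h rest))
      ≡⟨ cong (window v 0) (sym (length-concatMap-++ h (window b 0 n) rest)) ⟩
    window v 0 (length (concatMap h (window b 0 n ++ rest)))
      ≡⟨ cong (window v 0 ∘ length ∘ concatMap h) (sym split) ⟩
    window v 0 (length (concatMap h (fixedPrefix n)))
      ≡⟨ prefix n ⟩
    concatMap h (fixedPrefix n)
      ≡⟨ cong (concatMap h) split ⟩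
    concatMap h (window b 0 n ++ rest)
      ≡⟨ concatMap-++ h (window b 0 n) rest ⟩
    concatMap h (window b 0 n) ++ concatMap h rest ∎))
  where
  open ≡-Reasoning
  rest = window b n (length (fixedPrefix n) ∸ n)
  split : fixedPrefix n ≡ window b 0 n ++ rest
  split = begin
    fixedPrefix n                                  ≡⟨ sym (b-prefix n) ⟩
    window b 0 (length (fixedPrefix n))            ≡⟨ cong (window b 0) (sym (m+[n∸m]≡n (<⇒≤ (fixedPrefix-grows n)))) ⟩
    window b 0 (n + (length (fixedPrefix n) ∸ n))  ≡⟨ window-++ b 0 n _ ⟩
    window b 0 n ++ rest                           ∎

codedPrefix-extends : ∀ k → concatMap g (fixedPrefix (suc k)) ≡ concatMap g (fixedPrefix k) ++ concatMap g (fixedTail k)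
codedPrefix-extends k =
  trans (cong (concatMap g) (fixedPrefix-extends k)) (concatMap-++ g (fixedPrefix k) (fixedTail k))

codedPrefix-grows : ∀ k → k < length (concatMap g (fixedPrefix k))
codedPrefix-grows k = begin-strict
  k                                        <⟨ fixedPrefix-grows k ⟩
  length (fixedPrefix k)                   ≤⟨ m≤m*n _ 4 ⟩
  length (fixedPrefix k) * 4               ≤⟨ concatMap-length≥ g 4 |g|≥4 (fixedPrefix k) ⟩
  length (concatMap g (fixedPrefix k))     ∎
  where open ≤-Reasoning

open Limit false (concatMap g ∘ fixedPrefix) (concatMap g ∘ fixedTail) codedPrefix-extends codedPrefix-grows
  using () renaming (limit to w; limit-prefix to w-prefix)

-- Iterates are taken so that one block is at least as long as the windows studied: 6 letters for
-- `f²`, 190 for `gf³`. Each such window then lies in the image of two consecutive letters of `b`.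
f² f³ : Letter → List Letter
f² = concatMap f ∘ f
f³ = concatMap f ∘ f²

gf gf³ : Letter → List Bool
gf  = concatMap g ∘ f
gf³ = concatMap g ∘ f³

f-image : IsImage f b b
-- The image of `fixedPrefix k` under `f` is `fixedPrefix (suc k)` by definition.
f-image = image-of-b f b (b-prefix ∘ suc)

f²-image : IsImage f² b b
f²-image = IsImage-∘ f-image f-image

g-image : IsImage g b w
g-image = image-of-b g w w-prefix

gf-image : IsImage gf b w
gf-image = IsImage-∘ f-image g-image

gf³-image : IsImage gf³ b w
gf³-image = IsImage-∘ (IsImage-∘ f²-image f-image) g-image

|f²|≥16 : ∀ x → 16 ≤ length (f² x)
|f²|≥16 = forallLetters (λ x → 16 ≤? length (f² x))

|gf|≥19 : ∀ x → 19 ≤ length (gf x)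
|gf|≥19 = forallLetters (λ x → 19 ≤? length (gf x))

|gf|≤24 : ∀ x → length (gf x) ≤ 24
|gf|≤24 = forallLetters (λ x → length (gf x) ≤? 24)

|g|≤6 : ∀ x → length (g x) ≤ 6
|g|≤6 = forallLetters (λ x → length (g x) ≤? 6)

|gf³|≥190 : ∀ x → 190 ≤ length (gf³ x)
|gf³|≥190 = forallLetters (λ x → 190 ≤? length (gf³ x))

-- Short factors of the fixed point

pairs : List (List Letter)
pairs = (a₀ ∷ b₀ ∷ []) ∷ (a₀ ∷ b₁ ∷ []) ∷ (a₁ ∷ c₀ ∷ []) ∷ (b₀ ∷ a₀ ∷ []) ∷ (b₀ ∷ a₁ ∷ []) ∷
        (b₁ ∷ d₀ ∷ []) ∷ (c₀ ∷ b₀ ∷ []) ∷ (c₀ ∷ d₀ ∷ []) ∷ (d₀ ∷ a₀ ∷ []) ∷ (d₀ ∷ c₀ ∷ []) ∷ []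

windowsOfPair : {X : Set} → (Letter → List X) → ℕ → List Letter → List (List X)
windowsOfPair h k p = map (λ r → take k (drop r (concatMap h p))) (upTo (length (concatMap h (take 1 p))))

-- The window starts in some block and, being no longer than a block, ends within the next one. The
-- bound on `pos h b n` serves the recursion in `pair-factors`.
window-of-pair : {X : Set} (h : Letter → List X) (v : ℕ → X) → IsImage h b v → ∀ k →
  (∀ x → k ≤ length (h x)) → (∀ x → 1 ≤ length (h x)) → ∀ i → ∃ λ n →
  pos h b n ≤ i × window v i k ∈ windowsOfPair h k (window b n 2)
window-of-pair h v image k k≤ nonempty i with locate h b nonempty i
... | n , r , refl , r< = n , m≤m+n _ r , subst (_∈ windowsOfPair h k (window b n 2))
  (sym (window-in-image image n 2 r k r+k≤))
  (∈-map⁺ _ (∈-upTo⁺ (subst (λ xs → r < length xs) (sym (++-identityʳ (h (b n)))) r<)))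
  where
  r+k≤ : r + k ≤ length (concatMap h (window b n 2))
  r+k≤ = begin
    r + k                                                   ≤⟨ +-mono-≤ (<⇒≤ r<) (k≤ (b (suc n))) ⟩
    length (h (b n)) + length (h (b (suc n)))
      ≡⟨ cong (λ xs → length (h (b n)) + length xs) (sym (++-identityʳ (h (b (suc n))))) ⟩
    length (h (b n)) + length (concatMap h (window b (suc n) 1))
      ≡⟨ sym (length-++ (h (b n))) ⟩
    length (concatMap h (window b n 2))                     ∎
    where open ≤-Reasoning

pairs-closed : All (λ p → All (_∈ pairs) (windowsOfPair f 2 p)) pairs
pairs-closed = toWitness {a? = All.all? (λ p → All.all? (_∈ᵂ? pairs) (windowsOfPair f 2 p)) pairs} _
  where open DecMembership _≟ᵂ_ renaming (_∈?_ to _∈ᵂ?_)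

-- Strong induction: the pair at a positive `i` lies in the `f` image of the pair at some `n`, and
-- `n < i` because blocks have at least four letters. The list is closed under this passage.
pair-factors : ∀ i → window b i 2 ∈ pairs
pair-factors = <-rec _ step
  where
  step : ∀ i → (∀ {n} → n < i → window b n 2 ∈ pairs) → window b i 2 ∈ pairs
  step zero    rec = here refl
  step i@(suc _) rec with window-of-pair f b f-image 2
    (λ x → ≤-trans (from-yes (2 ≤? 4)) (|f|≥4 x)) (λ x → ≤-trans (s≤s z≤n) (|f|≥4 x)) i
  ... | n , pos≤i , w∈ = All.lookup (All.lookup pairs-closed (rec (≰⇒> n≱i))) w∈
    where
    n≱i : ¬ i ≤ n
    n≱i i≤n = <⇒≱ (m<m*n i 4 (s≤s (s≤s z≤n))) (begin
      i * 4                          ≤⟨ *-monoˡ-≤ 4 i≤n ⟩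
      n * 4                          ≡⟨ cong (_* 4) (sym (length-window b 0 n)) ⟩
      length (window b 0 n) * 4      ≤⟨ concatMap-length≥ f 4 |f|≥4 (window b 0 n) ⟩
      pos f b n                      ≤⟨ pos≤i ⟩
      i                              ∎)
      where open ≤-Reasoning

-- A finite check over the images of the ten pairs settles all windows of length `k` of the infinite
-- word.
window-property : {X : Set} (h : Letter → List X) (v : ℕ → X) → IsImage h b v → ∀ k →
  (∀ x → k ≤ length (h x)) → (∀ x → 1 ≤ length (h x)) → (P : List X → Set) →
  (∀ p x → p ∈ pairs → x ∈ windowsOfPair h k p → P x) → ∀ i → P (window v i k)
window-property h v image k k≤ nonempty P holds i =
  let n , _ , x∈ = window-of-pair h v image k k≤ nonempty i
  in holds (window b n 2) (window v i k) (pair-factors n) x∈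

sixes : List (List Letter)
sixes = deduplicate _≟ᵂ_ (concatMap (windowsOfPair f² 6) pairs)

startsAgree? : ∀ xs → Dec (All (λ x → All (λ y →
  take 25 (concatMap gf x) ≡ take 25 (concatMap gf y) → take 1 x ≡ take 1 y) xs) xs)
startsAgree? xs = All.all? (λ x → All.all? (λ y →
  (take 25 (concatMap gf x) ≟ᴮ take 25 (concatMap gf y)) →-dec (take 1 x ≟ᵂ take 1 y)) xs) xs

-- From a known block boundary, `gf` can be decoded left to right. The 25 letters are needed because
-- `gf a₀` is a prefix of `gf a₁`: followed by their successors in `b`, the two first differ at the
-- 25th letter. The same holds for `b₀` and `b₁`.
block-determined : All (λ x → All (λ y →
  take 25 (concatMap gf x) ≡ take 25 (concatMap gf y) → take 1 x ≡ take 1 y) sixes) sixes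
block-determined = toWitness {a? = startsAgree? sixes} _

-- A position inside the second block of the image of a six letter factor; the suffix is the rest of
-- that image, stored so that the checks below compute it only once.
record Site : Set where
  constructor site
  field
    context : List Letter
    offset  : ℕ
    suffix  : List Bool

sitesIn : List Letter → List Site
sitesIn x = map (λ r → let e = length (concatMap gf (take 1 x)) + r in site x e (drop e (concatMap gf x)))
                (upTo (length (concatMap gf (take 1 (drop 1 x)))))

sites : List (List Letter) → List Site
sites = concatMap sitesIn

-- Descent of squares from gf(b) to g(b)

commonPrefix : List Bool → List Bool → ℕ
commonPrefix (x ∷ xs) (y ∷ ys) = if does (x Boolₚ.≟ y) then suc (commonPrefix xs ys) else 0
commonPrefix _        _        = 0

-- The largest `k`, up to the end of the third block, that the left condition `AgreeLeft` permits. A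
-- larger `k` leaves a shorter suffix to compare on the right, so this is the best candidate.
cutoff : List (List Letter) → Site → ℕ
cutoff xs (site y e _) = foldr _⊓_ (length (concatMap g (take 3 y)))
  (map (λ z → commonPrefix (concatMap g z) (concatMap g y))
       (filter (λ z → take e (concatMap gf z) ≟ᴮ take e (concatMap gf y)) xs))

-- Let s be the site in the middle of a square of gf(b). The end and the beginning of the square look
-- like s on one side only. Their blocks need not be those around s, but the images under g agree
-- on the left up to position k of g(y) and on the right from there on, which is all that a square of
-- g(b) requires.
AgreeLeft : ℕ → Site → List Letter → Set
AgreeLeft k (site y e _) z =
  take e (concatMap gf z) ≡ take e (concatMap gf y) → take k (concatMap g z) ≡ take k (concatMap g y)

agreeLeft? : ∀ k s z → Dec (AgreeLeft k s z)
agreeLeft? k (site y e _) z =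
  (take e (concatMap gf z) ≟ᴮ take e (concatMap gf y)) →-dec (take k (concatMap g z) ≟ᴮ take k (concatMap g y))

-- The third block boundary of the first context is matched with the j-th one of the second.
Aligned : ℕ → Site → Site → ℕ → Set
Aligned k (site y e _) (site x d _) j =
  length (concatMap gf (take j x)) + e ≡ length (concatMap gf (take 3 y)) + d ×
  drop k (concatMap g (take 3 y)) ≡
    drop (length (concatMap g (take j x)) ∸ (length (concatMap g (take 3 y)) ∸ k)) (concatMap g (take j x))

aligned? : ∀ k s s′ j → Dec (Aligned k s s′ j)
aligned? k (site y e _) (site x d _) j =
  (length (concatMap gf (take j x)) + e ≟ length (concatMap gf (take 3 y)) + d) ×-dec
  (drop k (concatMap g (take 3 y)) ≟ᴮ
    drop (length (concatMap g (take j x)) ∸ (length (concatMap g (take 3 y)) ∸ k)) (concatMap g (take j x)))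

-- The site `s` is in the middle of the square and `s′` at its beginning; the 46 compared letters
-- open the two halves. The candidates 2, 3, 4 count the blocks of the context of `s′` up to the
-- matched boundary.
AgreeRight : ℕ → Site → Site → Set
AgreeRight k s s′ = prefixAgree 46 (Site.suffix s) (Site.suffix s′) ≡ true → Any (Aligned k s s′) (2 ∷ 3 ∷ 4 ∷ [])

Separates : List (List Letter) → List Site → Site → ℕ → Set
Separates xs ss s k =
  (k ≤ length (concatMap g (take 3 (Site.context s))) × All (AgreeLeft k s) xs) × All (AgreeRight k s) ss

separatesLeft? : ∀ xs s k → Dec (k ≤ length (concatMap g (take 3 (Site.context s))) × All (AgreeLeft k s) xs)
separatesLeft? xs s k =
  (k ≤? length (concatMap g (take 3 (Site.context s)))) ×-dec All.all? (agreeLeft? k s) xs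

agreesRight : ℕ → Site → Site → Bool
agreesRight k s s′ =
  if prefixAgree 46 (Site.suffix s) (Site.suffix s′) then isYes (Any.any? (aligned? k s s′) (2 ∷ 3 ∷ 4 ∷ [])) else true

agreesRight-sound : ∀ k s s′ → T (agreesRight k s s′) → AgreeRight k s s′
agreesRight-sound k s s′ ok eq rewrite eq = toWitness {a? = Any.any? (aligned? k s s′) (2 ∷ 3 ∷ 4 ∷ [])} ok

separates : List (List Letter) → List Site → Site → ℕ → Bool
separates xs ss s k = isYes (separatesLeft? xs s k) ∧ all (agreesRight k s) ss

separates-sound : ∀ xs ss s k → T (separates xs ss s k) → Separates xs ss s k
separates-sound xs ss s k ok =
  let left , right = Equivalence.to (Boolₚ.T-∧ {isYes (separatesLeft? xs s k)} {all (agreesRight k s) ss}) ok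
  in toWitness {a? = separatesLeft? xs s k} left ,
     All.map (λ {s′} → agreesRight-sound k s s′) (Allₚ.all⁺ (agreesRight k s) ss right)

cutoffsSeparate : List (List Letter) → List Site → Bool
cutoffsSeparate xs ss = all (λ s → separates xs ss s (cutoff xs s)) ss

cutoffsSeparate-sound : ∀ xs ss → cutoffsSeparate xs ss ≡ true → All (λ s → ∃ (Separates xs ss s)) ss
cutoffsSeparate-sound xs ss ok = All.map (λ {s} ok → cutoff xs s , separates-sound xs ss s (cutoff xs s) ok)
  (Allₚ.all⁺ (λ s → separates xs ss s (cutoff xs s)) ss (Equivalence.from Boolₚ.T-≡ ok))

cutoffs-separate : All (λ s → ∃ (Separates sixes (sites sixes) s)) (sites sixes)
cutoffs-separate = cutoffsSeparate-sound sixes (sites sixes) refl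

-- The last hypothesis says that two boundaries lie equally far from `i` and from `i + p`; hence
-- they are `p` apart.
align : ∀ {i p} m n {d e x y} → i ≡ n + d → i + p ≡ m + e → x + e ≡ y + d → m + y ≡ n + x + p
align {i} {p} m n {d} {e} {x} {y} refl ip≡ xe≡yd = +-cancelʳ-≡ (d + e) _ _ (begin
  m + y + (d + e)      ≡⟨ lemma₁ m y d e ⟩
  m + e + (y + d)      ≡⟨ cong₂ _+_ (sym ip≡) (sym xe≡yd) ⟩
  n + d + p + (x + e)  ≡⟨ lemma₂ n d p x e ⟩
  n + x + p + (d + e)  ∎)
  where
  open ≡-Reasoning
  lemma₁ : ∀ m y d e → m + y + (d + e) ≡ m + e + (y + d)
  lemma₁ = solve-∀
  lemma₂ : ∀ n d p x e → n + d + p + (x + e) ≡ n + x + p + (d + e)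
  lemma₂ = solve-∀

-- Abstract in b and w, because unfolding them makes type checking infeasible.
module Descent (b : ℕ → Letter) (w : ℕ → Bool) (g-image : IsImage g b w) (gf-image : IsImage gf b w)
  (xs : List (List Letter)) (six-factors : ∀ i → window b i 6 ∈ xs)
  (block-determined : All (λ x → All (λ y →
    take 25 (concatMap gf x) ≡ take 25 (concatMap gf y) → take 1 x ≡ take 1 y) xs) xs)
  (cutoffs-separate : All (λ s → ∃ (Separates xs (sites xs) s)) (sites xs)) where

  siteAt : ℕ → ℕ → Site
  siteAt n e = site (window b n 6) e (drop e (concatMap gf (window b n 6)))

  -- Here `block` is where the context starts, so `i` itself lies in the block after it. The offset
  -- spans less than two blocks of at most 24 letters.
  record Located (i : ℕ) : Set where
    constructor located
    field
      block offset : ℕ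
      position     : i ≡ pos gf b block + offset
      is-site      : siteAt block offset ∈ sites xs
      after        : pos gf b (1 + block) ≤ i
      before       : i < pos gf b (2 + block)
      offset<48    : offset < 48

  locate-site : ∀ i → pos gf b 1 ≤ i → Located i
  locate-site i 1≤i with locate gf b (λ x → ≤-trans (s≤s z≤n) (|gf|≥19 x)) i
  -- A position in the very first block has no block to its left and is excluded by hypothesis.
  ... | zero  , r , refl , r< = contradiction 1≤i (<⇒≱ (subst (r <_) (sym (cong length (++-identityʳ (gf (b 0))))) r<))
  ... | suc n , r , refl , r< = located n e position
    (∈-concatMap⁺ sitesIn (lose (six-factors n) (∈-map⁺ _ (∈-upTo⁺ (subst (r <_) (sym len₁) r<)))))
    (m≤m+n _ r)
    (subst (pos gf b (suc n) + r <_) (sym (pos-suc gf b (suc n))) (+-monoʳ-< (pos gf b (suc n)) r<))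
    (+-mono-≤-< (length-image-window≤ gf b 24 |gf|≤24 n 1) (<-≤-trans r< (|gf|≤24 (b (suc n)))))
    where
    len₁ : length (concatMap gf (window b (suc n) 1)) ≡ length (gf (b (suc n)))
    len₁ = cong length (++-identityʳ (gf (b (suc n))))
    e = length (concatMap gf (window b n 1)) + r
    position : pos gf b (suc n) + r ≡ pos gf b n + e
    position = begin
      pos gf b (suc n) + r   ≡⟨ cong (λ k → pos gf b k + r) (+-comm 1 n) ⟩
      pos gf b (n + 1) + r   ≡⟨ cong (_+ r) (pos-+ gf b n 1) ⟩
      pos gf b n + length (concatMap gf (window b n 1)) + r ≡⟨ +-assoc (pos gf b n) _ r ⟩
      pos gf b n + e         ∎
      where open ≡-Reasoning

  |6|≥114 : ∀ i → 114 ≤ length (concatMap gf (window b i 6))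
  |6|≥114 i = length-image-window≥ gf b 19 |gf|≥19 i 6

  two-blocks : ∀ n → pos gf b n + 25 ≤ pos gf b (n + 2)
  two-blocks n = begin
    pos gf b n + 25                                    ≤⟨ +-monoʳ-≤ (pos gf b n) (from-yes (25 ≤? 38)) ⟩
    pos gf b n + 38                                    ≤⟨ +-monoʳ-≤ (pos gf b n) (length-image-window≥ gf b 19 |gf|≥19 n 2) ⟩
    pos gf b n + length (concatMap gf (window b n 2))  ≡⟨ sym (pos-+ gf b n 2) ⟩
    pos gf b (n + 2)                                   ∎
    where open ≤-Reasoning

  module _ (i p : ℕ) (96≤p : 96 ≤ p) (ag : Agree w i (i + p) p) where

    shift : ∀ j k → i ≤ j → j + k ≤ i + p → Agree w j (j + p) k
    shift j k i≤j j+k≤ = subst₂ (λ s t → Agree w s t k) j≡ j+p≡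
      (Agree-sub w (j ∸ i) k
        (+-cancelˡ-≤ i _ _ (subst (_≤ i + p) (trans (cong (_+ k) (sym j≡)) (+-assoc i (j ∸ i) k)) j+k≤)) ag)
      where
      j≡ : i + (j ∸ i) ≡ j
      j≡ = m+[n∸m]≡n i≤j
      j+p≡ : i + p + (j ∸ i) ≡ j + p
      j+p≡ = trans (swap-last i p (j ∸ i)) (cong (_+ p) j≡)

    -- Decoding runs in parallel from two boundaries at distance `p`: the next 25 letters agree, so
    -- by `block-determined` the next letters of `b` agree and the following boundaries are again
    -- `p` apart. The bound by `i + p` keeps two blocks of lookahead inside the range where the
    -- square guarantees agreement.
    chain : ∀ α β t → i ≤ pos gf b α → pos gf b (suc (α + t)) ≤ i + p → pos gf b β ≡ pos gf b α + p →
            Agree b α β t × pos gf b (β + t) ≡ pos gf b (α + t) + p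
    chain α β zero i≤ _ eq rewrite +-identityʳ α | +-identityʳ β = (λ _ ()) , eq
    chain α β (suc t) i≤ ≤ip eq with chain α β t i≤ (≤-trans (pos-mono-≤ gf b (s≤s (+-monoʳ-≤ α (n≤1+n t)))) ≤ip) eq
    ... | agree , eq′ = subst (Agree b α β) (+-comm t 1) (Agree-++ b t 1 agree one) , (begin
        pos gf b (β + suc t)                ≡⟨ cong (pos gf b) (+-suc β t) ⟩
        pos gf b (suc v)                    ≡⟨ pos-suc gf b v ⟩
        pos gf b v + length (gf (b v))      ≡⟨ cong₂ (λ n x → n + length (gf x)) eq′ (sym bu≡bv) ⟩
        pos gf b u + p + length (gf (b u))  ≡⟨ swap-last (pos gf b u) p _ ⟩
        pos gf b u + length (gf (b u)) + p  ≡⟨ cong (_+ p) (sym (pos-suc gf b u)) ⟩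
        pos gf b (suc u) + p                ≡⟨ cong (λ n → pos gf b n + p) (sym (+-suc α t)) ⟩
        pos gf b (α + suc t) + p            ∎)
      where
      open ≡-Reasoning
      u = α + t
      v = β + t
      room : pos gf b u + 25 ≤ i + p
      room = ≤-trans (two-blocks u)
        (subst (λ n → pos gf b n ≤ i + p) (trans (cong suc (+-suc α t)) (+-comm 2 u)) ≤ip)
      i≤u : i ≤ pos gf b u
      i≤u = ≤-trans i≤ (pos-mono-≤ gf b (m≤m+n α t))
      25≤ : ∀ n → 25 ≤ length (concatMap gf (window b n 6))
      25≤ n = ≤-trans (from-yes (25 ≤? 114)) (|6|≥114 n)
      same : take 25 (concatMap gf (window b u 6)) ≡ take 25 (concatMap gf (window b v 6))
      same = begin
        take 25 (concatMap gf (window b u 6))  ≡⟨ sym (take-image gf-image u 6 25 (25≤ u)) ⟩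
        window w (pos gf b u) 25               ≡⟨ Agree⇒window w _ _ 25 (shift (pos gf b u) 25 i≤u room) ⟩
        window w (pos gf b u + p) 25           ≡⟨ cong (λ n → window w n 25) (sym eq′) ⟩
        window w (pos gf b v) 25               ≡⟨ take-image gf-image v 6 25 (25≤ v) ⟩
        take 25 (concatMap gf (window b v 6))  ∎
      bu≡bv : b u ≡ b v
      bu≡bv = ∷-injectiveˡ (All.lookup (All.lookup block-determined (six-factors u)) (six-factors v) same)
      one : Agree b u v 1
      one = Agree-cons b bu≡bv (λ _ ())

    Result : Set
    Result = ∃₂ λ k q → Agree w k (k + q) q × q < p × p ≤ 5 * q

    -- The boundaries `α` and `β` are `p` apart, and `span` is the factor of `b` between them. The
    -- new half has three pieces: `S` letters before `α` matched with those before `β` by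
    -- `suffixes`; the image of `t` letters matched by `chain`; and `k` letters after `m` matched
    -- with those after `β + t` by `left`. Then `p` and `q` are the lengths of the images of `span`
    -- under `gf` and `g`, which gives the bounds on `q`.
    assemble : ∀ n j t e k → 2 ≤ j → let m = n + j + t in
      i + p ≡ pos gf b m + e → i < pos gf b (2 + n) → pos gf b (1 + m) ≤ i + p → e < 48 →
      pos gf b (m + 3) ≡ pos gf b (n + j) + p →
      k ≤ length (concatMap g (window b m 3)) →
      All (AgreeLeft k (siteAt m e)) xs →
      drop k (concatMap g (window b m 3)) ≡
        drop (length (concatMap g (window b n j)) ∸ (length (concatMap g (window b m 3)) ∸ k)) (concatMap g (window b n j)) →
      Result
    assemble n j t e k 2≤j ip≡ i< m₁≤ e<48 aligned k≤ left suffixes =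
      start , q , subst (λ s → Agree w start s q) end≡ agree-all , q<p , p≤5q
      where
      open ≡-Reasoning
      m = n + j + t
      α = n + j
      β = m + 3
      Xg = length (concatMap g (window b n j))
      Yg = length (concatMap g (window b m 3))
      S = Yg ∸ k
      D = Xg ∸ S
      start = pos g b n + D
      end = pos g b m + k
      i≤α : i ≤ pos gf b α
      i≤α = <⇒≤ (<-≤-trans i< (pos-mono-≤ gf b (≤-trans (≤-reflexive (+-comm 2 n)) (+-monoʳ-≤ n 2≤j))))
      i≤m : i ≤ pos gf b m
      i≤m = ≤-trans i≤α (pos-mono-≤ gf b (m≤m+n α t))
      chained = chain α β t i≤α m₁≤ aligned
      -- Three blocks of `g` have at most 18 letters, and 24 is a lower bound for six blocks.
      k≤24 : k ≤ 24
      k≤24 = ≤-trans k≤ (≤-trans (length-image-window≤ g b 6 |g|≤6 m 3) (from-yes (18 ≤? 24)))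
      e≤ : ∀ n → e ≤ length (concatMap gf (window b n 6))
      e≤ n = ≤-trans (<⇒≤ e<48) (≤-trans (from-yes (48 ≤? 114)) (|6|≥114 n))
      k≤6 : ∀ n → k ≤ length (concatMap g (window b n 6))
      k≤6 n = ≤-trans k≤24 (length-image-window≥ g b 4 |g|≥4 n 6)
      left-gf : take e (concatMap gf (window b (β + t) 6)) ≡ take e (concatMap gf (window b m 6))
      left-gf = begin
        take e (concatMap gf (window b (β + t) 6))  ≡⟨ sym (take-image gf-image (β + t) 6 e (e≤ (β + t))) ⟩
        window w (pos gf b (β + t)) e               ≡⟨ cong (λ s → window w s e) (proj₂ chained) ⟩
        window w (pos gf b m + p) e                 ≡⟨ sym (Agree⇒window w _ _ e (shift (pos gf b m) e i≤m (≤-reflexive (sym ip≡)))) ⟩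
        window w (pos gf b m) e                     ≡⟨ take-image gf-image m 6 e (e≤ m) ⟩
        take e (concatMap gf (window b m 6))        ∎
      left-g : Agree w (pos g b m) (pos g b (β + t)) k
      left-g = window⇒Agree w _ _ k (begin
        window w (pos g b m) k                     ≡⟨ take-image g-image m 6 k (k≤6 m) ⟩
        take k (concatMap g (window b m 6))        ≡⟨ sym (All.lookup left (six-factors (β + t)) left-gf) ⟩
        take k (concatMap g (window b (β + t) 6))  ≡⟨ sym (take-image g-image (β + t) 6 k (k≤6 (β + t))) ⟩
        window w (pos g b (β + t)) k               ∎)
      -- Comparing the lengths in `suffixes` shows that the subtraction defining `D` was not
      -- truncated.
      S≡ : Xg ∸ D ≡ S
      S≡ = trans (sym (length-drop D _)) (trans (cong length (sym suffixes)) (length-drop k _))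
      right-g : Agree w start end S
      right-g = window⇒Agree w _ _ S (begin
        window w start S                      ≡⟨ cong (window w start) (sym S≡) ⟩
        window w start (Xg ∸ D)               ≡⟨ drop-image g-image n j D (m∸n≤m Xg S) ⟩
        drop D (concatMap g (window b n j))   ≡⟨ sym suffixes ⟩
        drop k (concatMap g (window b m 3))   ≡⟨ sym (drop-image g-image m 3 k k≤) ⟩
        window w end S                        ∎)
      start+S : start + S ≡ pos g b α
      start+S = begin
        pos g b n + D + S            ≡⟨ +-assoc (pos g b n) D S ⟩
        pos g b n + (D + S)          ≡⟨ cong (λ s → pos g b n + (D + s)) (sym S≡) ⟩
        pos g b n + (D + (Xg ∸ D))   ≡⟨ cong (pos g b n +_) (m+[n∸m]≡n (m∸n≤m Xg S)) ⟩
        pos g b n + Xg               ≡⟨ sym (pos-+ g b n j) ⟩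
        pos g b α                    ∎
      end+S : end + S ≡ pos g b β
      end+S = begin
        pos g b m + k + S      ≡⟨ +-assoc (pos g b m) k S ⟩
        pos g b m + (k + S)    ≡⟨ cong (pos g b m +_) (m+[n∸m]≡n k≤) ⟩
        pos g b m + Yg         ≡⟨ sym (pos-+ g b m 3) ⟩
        pos g b β              ∎
      M = length (concatMap g (window b α t))
      middle≡ : window b α t ≡ window b β t
      middle≡ = Agree⇒window b α β t (proj₁ chained)
      middle-g : Agree w (pos g b α) (pos g b β) M
      middle-g = window⇒Agree w _ _ M (begin
        window w (pos g b α) M  ≡⟨ window-image g-image α t ⟩
        concatMap g (window b α t) ≡⟨ cong (concatMap g) middle≡ ⟩
        concatMap g (window b β t) ≡⟨ sym (window-image g-image β t) ⟩
        window w (pos g b β) (length (concatMap g (window b β t)))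
          ≡⟨ cong (window w (pos g b β) ∘ length ∘ concatMap g) (sym middle≡) ⟩
        window w (pos g b β) M  ∎)
      α+M : pos g b α + M ≡ pos g b m
      α+M = sym (pos-+ g b α t)
      β+M : pos g b β + M ≡ pos g b (β + t)
      β+M = sym (trans (pos-+ g b β t) (cong (λ xs → pos g b β + length (concatMap g xs)) (sym middle≡)))
      q = S + M + k
      start+S+M : start + (S + M) ≡ pos g b m
      start+S+M = trans (sym (+-assoc start S M)) (trans (cong (_+ M) start+S) α+M)
      end+S+M : end + (S + M) ≡ pos g b (β + t)
      end+S+M = trans (sym (+-assoc end S M)) (trans (cong (_+ M) end+S) β+M)
      agree-all : Agree w start end q
      agree-all = Agree-++ w (S + M) k
        (Agree-++ w S M right-g (subst₂ (λ s s′ → Agree w s s′ M) (sym start+S) (sym end+S) middle-g))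
        (subst₂ (λ s s′ → Agree w s s′ k) (sym start+S+M) (sym end+S+M) left-g)
      end≡ : end ≡ start + q
      end≡ = sym (trans (sym (+-assoc start (S + M) k)) (cong (_+ k) start+S+M))
      span = window b α (t + 3)
      β≡ : β ≡ α + (t + 3)
      β≡ = +-assoc α t 3
      q≡ : q ≡ length (concatMap g span)
      q≡ = +-cancelˡ-≡ (pos g b α) _ _ (begin
        pos g b α + q          ≡⟨ cong (_+ q) (sym start+S) ⟩
        start + S + q          ≡⟨ swap-last start S q ⟩
        start + q + S          ≡⟨ cong (_+ S) (sym end≡) ⟩
        end + S                ≡⟨ end+S ⟩
        pos g b β              ≡⟨ cong (pos g b) β≡ ⟩
        pos g b (α + (t + 3))  ≡⟨ pos-+ g b α (t + 3) ⟩
        pos g b α + length (concatMap g span) ∎)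
      p≡ : p ≡ length (concatMap gf span)
      p≡ = +-cancelˡ-≡ (pos gf b α) _ _ (trans (sym aligned) (trans (cong (pos gf b) β≡) (pos-+ gf b α (t + 3))))
      p≤5q : p ≤ 5 * q
      p≤5q = subst₂ (λ p q → p ≤ 5 * q) (sym p≡) (sym q≡) (subst (_≤ 5 * length (concatMap g span)) (*-identityˡ _)
        (concatMap-length-ratio gf g 1 5 (forallLetters (λ x → 1 * length (gf x) ≤? 5 * length (g x))) span))
      2q≤p : 2 * q ≤ p
      2q≤p = subst₂ (λ p q → 2 * q ≤ p) (sym p≡) (sym q≡) (subst (2 * length (concatMap g span) ≤_) (*-identityˡ _)
        (concatMap-length-ratio g gf 2 1 (forallLetters (λ x → 2 * length (g x) ≤? 1 * length (gf x))) span))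
      q<p : q < p
      q<p with q in eq
      ... | zero   = ≤-trans (s≤s z≤n) 96≤p
      ... | suc q′ = <-≤-trans (m<m+n (suc q′) (s≤s z≤n)) (subst (λ q → 2 * q ≤ p) eq 2q≤p)

    descend : pos gf b 1 ≤ i → Result
    descend 1≤i = go (locate-site i 1≤i) (locate-site (i + p) (≤-trans 1≤i (m≤m+n i p)))
      where
      go : Located i → Located (i + p) → Result
      go (located n d i≡ x∈ n₁≤ <n₂ d<48) (located m e ip≡ y∈ m₁≤ <m₂ e<48) =
        cases (proj₂ (All.lookup cutoffs-separate y∈))
        where
        site-window : ∀ {j} n d → j ≡ pos gf b n + d → d < 48 →
          drop d (concatMap gf (window b n 6)) ≡ window w j (length (concatMap gf (window b n 6)) ∸ d)
        site-window n d refl d<48 = sym (drop-image gf-image n 6 d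
          (≤-trans (<⇒≤ d<48) (≤-trans (from-yes (48 ≤? 114)) (|6|≥114 n))))
        46≤ : ∀ n {d} → d < 48 → 46 ≤ length (concatMap gf (window b n 6)) ∸ d
        46≤ n {d} d<48 = ≤-trans (from-yes (46 ≤? 114 ∸ 48)) (∸-mono (|6|≥114 n) (<⇒≤ d<48))
        same : prefixAgree 46 (drop e (concatMap gf (window b m 6))) (drop d (concatMap gf (window b n 6))) ≡ true
        same = subst₂ (λ xs ys → prefixAgree 46 xs ys ≡ true) (sym (site-window m e ip≡ e<48)) (sym (site-window n d i≡ d<48))
          (prefixAgree-window w (i + p) i 46 _ _ (46≤ m e<48) (46≤ n d<48)
            (λ t t<46 → sym (shift i 46 ≤-refl (+-monoʳ-≤ i (≤-trans (from-yes (46 ≤? 96)) 96≤p)) t t<46)))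
        -- The threshold 96 is four blocks of at most 24 letters: the matched boundary near `i` does
        -- not pass the start of the context at `i + p`.
        far : ∀ j → j ≤ 4 → n + j ≤ m
        far j j≤4 = ≮⇒≥ λ m<n+j → <⇒≱ <m₂ (begin
          pos gf b (2 + m)          ≤⟨ pos-mono-≤ gf b (≤-trans (s≤s m<n+j) (s≤s (+-monoʳ-≤ n j≤4))) ⟩
          pos gf b (suc n + 4)      ≡⟨ pos-+ gf b (suc n) 4 ⟩
          pos gf b (suc n) + length (concatMap gf (window b (suc n) 4))
                                    ≤⟨ +-mono-≤ n₁≤ (length-image-window≤ gf b 24 |gf|≤24 (suc n) 4) ⟩
          i + 96                    ≤⟨ +-monoʳ-≤ i 96≤p ⟩
          i + p                     ∎)
          where open ≤-Reasoning
        cases : ∀ {k} → Separates xs (sites xs) (siteAt m e) k → Result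
        cases {k} ((k≤ , left) , right) = decide (All.lookup right x∈ same)
          where
          build : ∀ j → 2 ≤ j → j ≤ 4 → Aligned k (siteAt m e) (siteAt n d) j → Result
          build j 2≤j j≤4 (len≡ , suf≡) with m≤n⇒∃[o]m+o≡n (far j j≤4)
          ... | t , refl = assemble n j t e k 2≤j ip≡ <n₂ m₁≤ e<48
            (trans (pos-+ gf b m 3) (trans (align (pos gf b m) (pos gf b n) i≡ ip≡
              (subst (λ x → length (concatMap gf x) + e ≡ length (concatMap gf (window b m 3)) + d) prefix len≡))
              (cong (_+ p) (sym (pos-+ gf b n j)))))
            k≤ left
            (subst (λ x → drop k (concatMap g (window b m 3)) ≡
              drop (length (concatMap g x) ∸ (length (concatMap g (window b m 3)) ∸ k)) (concatMap g x)) prefix suf≡)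
            where
            prefix : take j (window b n 6) ≡ window b n j
            prefix = take-window b n j 6 (≤-trans j≤4 (from-yes (4 ≤? 6)))
          decide : Any (Aligned k (siteAt m e) (siteAt n d)) (2 ∷ 3 ∷ 4 ∷ []) → Result
          decide (here al)                 = build 2 (from-yes (2 ≤? 2)) (from-yes (2 ≤? 4)) al
          decide (there (here al))         = build 3 (from-yes (2 ≤? 3)) (from-yes (3 ≤? 4)) al
          decide (there (there (here al))) = build 4 (from-yes (2 ≤? 4)) (from-yes (4 ≤? 4)) al

six-factors : ∀ i → window b i 6 ∈ sixes
six-factors = window-property f² b f²-image 6
  (λ x → ≤-trans (from-yes (6 ≤? 16)) (|f²|≥16 x)) (λ x → ≤-trans (s≤s z≤n) (|f²|≥16 x)) (_∈ sixes)
  (λ p x p∈ x∈ → ∈-deduplicate⁺ _≟ᵂ_ (∈-concatMap⁺ (windowsOfPair f² 6) (lose p∈ x∈)))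

-- Squares of bounded period

squares : List (List Bool)
squares =
  (𝟎 ∷ 𝟎 ∷ []) ∷ (𝟏 ∷ 𝟏 ∷ []) ∷ (𝟎 ∷ 𝟏 ∷ 𝟎 ∷ 𝟏 ∷ []) ∷ (𝟏 ∷ 𝟎 ∷ 𝟏 ∷ 𝟎 ∷ []) ∷
  (𝟎 ∷ 𝟎 ∷ 𝟏 ∷ 𝟎 ∷ 𝟎 ∷ 𝟏 ∷ []) ∷ (𝟎 ∷ 𝟏 ∷ 𝟎 ∷ 𝟎 ∷ 𝟏 ∷ 𝟎 ∷ []) ∷ (𝟎 ∷ 𝟏 ∷ 𝟏 ∷ 𝟎 ∷ 𝟏 ∷ 𝟏 ∷ []) ∷
  (𝟏 ∷ 𝟎 ∷ 𝟎 ∷ 𝟏 ∷ 𝟎 ∷ 𝟎 ∷ []) ∷ (𝟏 ∷ 𝟎 ∷ 𝟏 ∷ 𝟏 ∷ 𝟎 ∷ 𝟏 ∷ []) ∷ (𝟏 ∷ 𝟏 ∷ 𝟎 ∷ 𝟏 ∷ 𝟏 ∷ 𝟎 ∷ []) ∷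
  (𝟎 ∷ 𝟏 ∷ 𝟏 ∷ 𝟎 ∷ 𝟏 ∷ 𝟎 ∷ 𝟎 ∷ 𝟏 ∷ 𝟎 ∷ 𝟏 ∷ 𝟏 ∷ 𝟎 ∷ 𝟏 ∷ 𝟎 ∷ 𝟎 ∷ 𝟏 ∷ []) ∷
  (𝟏 ∷ 𝟎 ∷ 𝟎 ∷ 𝟏 ∷ 𝟎 ∷ 𝟏 ∷ 𝟏 ∷ 𝟎 ∷ 𝟏 ∷ 𝟎 ∷ 𝟎 ∷ 𝟏 ∷ 𝟎 ∷ 𝟏 ∷ 𝟏 ∷ 𝟎 ∷ []) ∷ []

powerOK : ℕ → List Bool → List Bool → Bool
powerOK p v d =
  if prefixAgree p v d
  then not (prefixAgree (suc (4 * p / 3)) v d) ∧ isYes (take (p + p) v ∈? squares)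
  else true

powersOK : ℕ → ℕ → List Bool → List Bool → Bool
powersOK zero    p v d          = true
-- A window too short for a period counts as a failure, so success certifies all `m` periods.
powersOK (suc m) p v []         = false
powersOK (suc m) p v d@(_ ∷ d′) = powerOK p v d ∧ powersOK m (suc p) v d′

powerOK-sound : ∀ p v d → powerOK p v d ≡ true → prefixAgree p v d ≡ true →
  prefixAgree (suc (4 * p / 3)) v d ≡ false × take (p + p) v ∈ squares
powerOK-sound p v d ok eq rewrite eq =
  Boolₚ.not-injective (Boolₚ.∧-conicalˡ _ (isYes listed?) ok) ,
  toWitness {a? = listed?} (Equivalence.from Boolₚ.T-≡ (Boolₚ.∧-conicalʳ _ (isYes listed?) ok))
  where listed? = take (p + p) v ∈? squares

powersOK-sound : ∀ m p v q → powersOK m p v (drop p v) ≡ true → p ≤ q → q < p + m →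
  prefixAgree q v (drop q v) ≡ true →
  prefixAgree (suc (4 * q / 3)) v (drop q v) ≡ false × take (q + q) v ∈ squares
powersOK-sound zero    p v q ok p≤q q<p+m eq = contradiction p≤q (<⇒≱ (subst (q <_) (+-identityʳ p) q<p+m))
powersOK-sound (suc m) p v q ok p≤q q<p+m eq with drop p v in drop≡
... | d@(_ ∷ d′) with m≤n⇒m<n∨m≡n p≤q
...   | inj₁ p<q = powersOK-sound m (suc p) v q
  (subst (λ d → powersOK m (suc p) v d ≡ true) (drop-suc p v (sym drop≡)) (Boolₚ.∧-conicalʳ (powerOK p v d) _ ok))
  p<q (subst (q <_) (+-suc p m) q<p+m) eq
...   | inj₂ refl = powerOK-sound p v (drop p v)
  (subst (λ d → powerOK p v d ≡ true) (sym drop≡) (Boolₚ.∧-conicalˡ (powerOK p v d) _ ok)) eq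

-- A record, so that comparing two instances does not evaluate powersOK on infinite words.
record PowersOK (v : List Bool) : Set where
  constructor powers-ok
  field
    holds : powersOK 95 1 v (drop 1 v) ≡ true

p≤excess : ∀ p → p ≤ suc (4 * p / 3)
p≤excess p = begin
  p                  ≡⟨ sym (m*n/n≡m p 3) ⟩
  p * 3 / 3          ≤⟨ /-monoˡ-≤ 3 (*-monoʳ-≤ p (from-yes (3 ≤? 4))) ⟩
  p * 4 / 3          ≡⟨ cong (_/ 3) (*-comm p 4) ⟩
  4 * p / 3          ≤⟨ n≤1+n _ ⟩
  suc (4 * p / 3)    ∎
  where open ≤-Reasoning

-- A window of 190 letters holds every square of period at most 95; longer periods go to `reduce`.
module Powers (u : InfWord) (ok : ∀ i → PowersOK (window u i 190))
  (reduce : ∀ i p → 96 ≤ p → Agree u i (i + p) p → ∃₂ λ k q → Agree u k (k + q) q × q < p × p ≤ 5 * q) where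

  prefixAgree-power : ∀ i p k → p + k ≤ 190 → Agree u i (i + p) k →
    prefixAgree k (window u i 190) (drop p (window u i 190)) ≡ true
  prefixAgree-power i p k p+k≤ ag = subst (λ d → prefixAgree k (window u i 190) d ≡ true)
    (sym (trans (cong (drop p ∘ window u i) (sym (m+[n∸m]≡n p≤))) (drop-window u i p (190 ∸ p))))
    (prefixAgree-window u i (i + p) k 190 (190 ∸ p) (≤-trans (m≤n+m k p) p+k≤)
      (subst (_≤ 190 ∸ p) (m+n∸m≡n p k) (∸-monoˡ-≤ p p+k≤)) ag)
    where p≤ = ≤-trans (m≤m+n p k) p+k≤

  short-square : ∀ i p → 1 ≤ p → p ≤ 95 → Agree u i (i + p) p →
    prefixAgree (suc (4 * p / 3)) (window u i 190) (drop p (window u i 190)) ≡ false × window u i (p + p) ∈ squares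
  short-square i p 1≤p p≤95 ag
    with powersOK-sound 95 1 (window u i 190) p (PowersOK.holds (ok i)) 1≤p (s≤s p≤95)
           (prefixAgree-power i p p (+-mono-≤ p≤95 p≤95) ag)
  ... | no-excess , x∈ = no-excess , subst (_∈ squares) (take-window u i (p + p) 190 (+-mono-≤ p≤95 p≤95)) x∈

  no-excess : ∀ i p → 1 ≤ p → p ≤ 8 → ¬ Agree u i (i + p) (suc (4 * p / 3))
  no-excess i p 1≤p p≤8 ag =
    false≢true (trans (sym (proj₁ (short-square i p 1≤p (≤-trans p≤8 (from-yes (8 ≤? 95))) square))) full-power)
    where
    false≢true : false ≢ true
    false≢true ()
    square : Agree u i (i + p) p
    square t t<p = ag t (<-≤-trans t<p (p≤excess p))
    full-power = prefixAgree-power i p (suc (4 * p / 3))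
      (≤-trans (+-mono-≤ p≤8 (s≤s (/-monoˡ-≤ 3 (*-monoʳ-≤ 4 p≤8)))) (from-yes (19 ≤? 190))) ag

  short-period≤8 : ∀ i p → 1 ≤ p → p ≤ 95 → Agree u i (i + p) p → p ≤ 8
  short-period≤8 i p 1≤p p≤95 ag = *-cancelʳ-≤ p 8 2 (subst (_≤ 16) p+p≡
    (All.lookup squares-length (proj₂ (short-square i p 1≤p p≤95 ag))))
    where
    squares-length : All (λ x → length x ≤ 16) squares
    squares-length = toWitness {a? = All.all? (λ x → length x ≤? 16) squares} _
    p+p≡ : length (window u i (p + p)) ≡ p * 2
    p+p≡ = trans (length-window u i (p + p)) (trans (cong (p +_) (sym (+-identityʳ p))) (*-comm 2 p))

  -- A period above 95 reduces to a smaller `q` with `p ≤ 5 * q`. By induction `q ≤ 8`, so `p ≤ 40`,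
  -- a contradiction.
  square-period≤8 : ∀ p → 1 ≤ p → ∀ i → Agree u i (i + p) p → p ≤ 8
  square-period≤8 = <-rec _ step
    where
    step : ∀ p → (∀ {q} → q < p → 1 ≤ q → ∀ i → Agree u i (i + q) q → q ≤ 8) →
           1 ≤ p → ∀ i → Agree u i (i + p) p → p ≤ 8
    step p rec 1≤p i ag with p ≤? 95
    ... | yes p≤95 = short-period≤8 i p 1≤p p≤95 ag
    ... | no  p≰95 with reduce i p (≰⇒> p≰95) ag
    ...   | k , q , ag′ , q<p , p≤5q =
      contradiction (≤-trans (≰⇒> p≰95) p≤5q) (<⇒≱ (s≤s (≤-trans (*-monoʳ-≤ 5 q≤8) (from-yes (40 ≤? 95)))))
      where
      q≤8 : q ≤ 8
      -- The induction hypothesis asks for a positive period, so `q = 0` is treated apart.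
      q≤8 with q ≟ 0
      ... | yes refl = z≤n
      ... | no  q≢0  = rec q<p (n≢0⇒n>0 q≢0) k ag′

  -- An exponent above `7/3` yields agreement on more than `4 * p / 3` letters at distance `p`. This
  -- contains a square of period `p`, so `p ≤ 8`, where the finite check excludes such an excess.
  exponent : ExponentAtMost7/3 u
  exponent i n p 1≤n ((1≤p , per) , _) = ≮⇒≥ λ 7p<3n → let k≤ = long 7p<3n in
    no-excess i p 1≤p (square-period≤8 p 1≤p i (agree p (≤-trans (+-monoʳ-≤ p (p≤excess p)) k≤))) (agree k k≤)
    where
    k = suc (4 * p / 3)
    agree : ∀ m → p + m ≤ n → Agree u i (i + p) m
    agree m p+m≤n t t<m = trans (per t (<-≤-trans (subst (_< p + m) (+-comm p t) (+-monoʳ-< p t<m)) p+m≤n))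
      (cong u (swap-last i t p))
    long : 7 * p < 3 * n → p + k ≤ n
    long 7p<3n = ≮⇒≥ λ n<p+k → <⇒≱ 7p<3n (begin
      3 * n                      ≤⟨ *-monoʳ-≤ 3 (s≤s⁻¹ (subst (n <_) (+-suc p (4 * p / 3)) n<p+k)) ⟩
      3 * (p + 4 * p / 3)        ≡⟨ *-distribˡ-+ 3 p (4 * p / 3) ⟩
      3 * p + 3 * (4 * p / 3)    ≤⟨ +-monoʳ-≤ (3 * p) (subst (_≤ 4 * p) (*-comm (4 * p / 3) 3) (m/n*n≤m (4 * p) 3)) ⟩
      3 * p + 4 * p              ≡⟨ sym (*-distribʳ-+ p 3 4) ⟩
      7 * p                      ∎)
      where open ≤-Reasoning

  square-listed : ∀ x → SquareFactor u x → x ∈ squares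
  square-listed x ((y , 1≤p , refl) , i , eq) = subst (_∈ squares) window≡
    (proj₂ (short-square i p 1≤p (≤-trans (square-period≤8 p 1≤p i ag) (from-yes (8 ≤? 95))) ag))
    where
    p = length y
    window≡ : window u i (p + p) ≡ y ++ y
    window≡ = trans (cong (window u i) (sym (length-++ y))) (trans (sym (factor≡window u i (length (y ++ y)))) eq)
    halves = ++-injective (window u i p) y (length-window u i p) (trans (sym (window-++ u i p p)) window≡)
    ag : Agree u i (i + p) p
    ag = window⇒Agree u i (i + p) p (trans (proj₁ halves) (sym (proj₂ halves)))

-- Recurrence and the remaining finite checks

-- The letter `a₀` occurs again at position 5 of `b`; applying `f` repeatedly to this occurrence
-- gives later occurrences of all the prefixes.
prefix-recurs : ∀ k → ∃ λ n → 1 ≤ n × window b n (length (fixedPrefix k)) ≡ fixedPrefix k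
prefix-recurs zero    = 5 , s≤s z≤n , refl
prefix-recurs (suc k) with prefix-recurs k
... | n , 1≤n , eq = pos f b n , 1≤pos , subst (λ xs → window b (pos f b n) (length (concatMap f xs)) ≡ concatMap f xs) eq
    (window-image {h = f} {b} {b} f-image n (length (fixedPrefix k)))
  where
  1≤pos : 1 ≤ pos f b n
  1≤pos = begin
    1                                                ≤⟨ 1≤n ⟩
    n                                                ≤⟨ m≤m*n n 4 ⟩
    n * 4                                            ≤⟨ length-image-window≥ f b 4 |f|≥4 0 n ⟩
    pos f b n                                        ∎
    where open ≤-Reasoning

-- The descent needs a full block to the left of the square. A prefix of `w` containing the square
-- is found again further right, which provides one.
square-recurs : ∀ i p → Agree w i (i + p) p → ∃ λ j → pos gf b 1 ≤ j × Agree w j (j + p) p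
square-recurs i p ag with prefix-recurs (i + p + p)
... | n , 1≤n , eq = s + i , ≤-trans (pos-mono-≤ gf b 1≤n) (m≤m+n s i) ,
    subst (λ j → Agree w (s + i) j p) (sym (+-assoc s i p)) (λ t t<p →
      trans (copy i t (<-≤-trans (+-monoʳ-< i t<p) (≤-trans (+-monoˡ-≤ p (m≤m+n i p)) ≤L)))
      (trans (ag t t<p) (sym (copy (i + p) t (<-≤-trans (+-monoʳ-< (i + p) t<p) ≤L)))))
  where
  open ≤-Reasoning
  s = pos gf b n
  xs = fixedPrefix (i + p + p)
  L = length (concatMap gf xs)
  ≤L : i + p + p ≤ L
  ≤L = begin
    i + p + p       ≤⟨ <⇒≤ (fixedPrefix-grows (i + p + p)) ⟩
    length xs       ≤⟨ m≤m*n (length xs) 19 ⟩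
    length xs * 19  ≤⟨ concatMap-length≥ gf 19 |gf|≥19 xs ⟩
    L               ∎
  at-s : window w s L ≡ concatMap gf xs
  at-s = subst (λ ys → window w s (length (concatMap gf ys)) ≡ concatMap gf ys) eq
    (window-image {h = gf} {b} {w} gf-image n (length xs))
  at-0 : window w 0 L ≡ concatMap gf xs
  at-0 = subst (λ ys → window w 0 (length (concatMap gf ys)) ≡ concatMap gf ys) (b-prefix (i + p + p))
    (gf-image (length xs))
  copy : ∀ i t → i + t < L → w (s + i + t) ≡ w (i + t)
  copy i t i+t<L = trans (cong w (+-assoc s i t)) (window⇒Agree w s 0 L (trans at-s (sym at-0)) (i + t) i+t<L)

windowsOK : List (List Letter) → Bool
windowsOK = all λ p → all (λ v → powersOK 95 1 v (drop 1 v)) (windowsOfPair gf³ 190 p)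

windowsOK-sound : ∀ ps → windowsOK ps ≡ true → ∀ p v → p ∈ ps → v ∈ windowsOfPair gf³ 190 p → PowersOK v
windowsOK-sound ps ok p v p∈ v∈ = powers-ok (Equivalence.to Boolₚ.T-≡ (All.lookup
  (Allₚ.all⁺ (λ v → powersOK 95 1 v (drop 1 v)) (windowsOfPair gf³ 190 p)
    (All.lookup (Allₚ.all⁺ _ ps (Equivalence.from Boolₚ.T-≡ ok)) p∈)) v∈))

windows-checked : windowsOK pairs ≡ true
windows-checked = refl

w-powersOK : ∀ i → PowersOK (window w i 190)
w-powersOK = window-property gf³ w gf³-image 190 |gf³|≥190 (λ x → ≤-trans (s≤s z≤n) (|gf³|≥190 x))
  PowersOK (windowsOK-sound pairs windows-checked)

w-reduce : ∀ i p → 96 ≤ p → Agree w i (i + p) p → ∃₂ λ k q → Agree w k (k + q) q × q < p × p ≤ 5 * q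
w-reduce i p 96≤p ag =
  let j , 1≤j , ag′ = square-recurs i p ag in descend j p 96≤p ag′ 1≤j
  where open Descent b w g-image gf-image sixes six-factors block-determined cutoffs-separate

squares-unique : Unique squares
squares-unique = toWitness {a? = unique? squares} _
  where open DecUnique _≟ᴮ_ using (unique?)

squares-occur : All (SquareFactor w) squares
squares-occur = All.map found (toWitness {a? = All.all? occurs? squares} _)
  where
  half : List Bool → List Bool
  half x = take ⌊ length x /2⌋ x
  Occurs : List Bool → Set
  -- The root of a square can only be its first half, and the first 80 positions suffice to find all
  -- twelve.
  Occurs x = (1 ≤ length (half x) × x ≡ half x ++ half x) × Any (λ i → factor w i (length x) ≡ x) (upTo 80)
  occurs? : ∀ x → Dec (Occurs x)
  occurs? x = ((1 ≤? length (half x)) ×-dec (x ≟ᴮ (half x ++ half x))) ×-dec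
              Any.any? (λ i → factor w i (length x) ≟ᴮ x) (upTo 80)
  found : ∀ {x} → Occurs x → SquareFactor w x
  found {x} ((1≤ , x≡) , occ) = (half x , 1≤ , x≡) , Any.satisfied occ

theorem2 : Σ InfWord (λ w → ExponentAtMost7/3 w × ExactlySquares 12 w)
    × ((w : InfWord) → ExponentAtMost7/3 w → AtLeastSquares 12 w)
theorem2 =
  (w , exponent , squares , squares-unique , refl ,
    λ x → All.lookup squares-occur , square-listed x) ,
  lower-bound
  where open Powers w w-powersOK w-reduce
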